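{- Let $s \geq 1$ be an integer and let $q = \max\{2, \lfloor (s-1)/2 \rfloor\}$. For every $n \geq q(2s+4) + s + 1$, \[ \left( s + \frac{2}{ s + 3 } \right) \frac{n}{2} - c_1 \leq \operatorname{sat}(n,P_5^{s-1}) \leq \left( s + \frac{2}{ s + 2 } \right) \frac{n}{2} + c_2, \] where $c_1 = (2s + 3)/(2s + 6) + (s+1)^2/8$ and $c_2 = s(s + 1)/(s + 2)$.
   Context: Graphs are finite and simple. A graph $G$ is $H$-saturated if $G$ contains no subgraph isomorphic to $H$ but adding any edge joining two nonadjacent vertices of $G$ creates such a subgraph; $\operatorname{sat}(n,H)$ is the minimum number of edges of an $H$-saturated graph on $n$ vertices. For an integer $r \ge 0$, the caterpillar $P_5^{r}$ is obtained from a path with $5$ vertices (length $4$) by attaching $r$ pendant edges (new leaves) to each of its three internal vertices. -}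

module Defs where

open import Data.Bool using (Bool; true; false; _∧_; _∨_; if_then_else_)
open import Data.Nat using (ℕ; zero; suc; _+_; _*_; _∸_; _^_; _≤_; _⊔_; ⌊_/2⌋; _<ᵇ_)
open import Data.Fin using (Fin; toℕ; _≟_)
open import Data.List using (List; map)
open import Data.Nat.ListAction using (sum)
open import Data.List using () renaming (allFin to allFinL)
open import Data.Product using (Σ; _×_; ∃; _,_)
open import Data.Sum using (_⊎_; inj₁; inj₂)
open import Relation.Binary.PropositionalEquality using (_≡_; _≢_)
open import Relation.Nullary using (¬_)
open import Relation.Nullary.Decidable using (⌊_⌋)
open import Function.Definitions using (Injective)
open import Data.Integer using (+_)
open import Data.Rational using (ℚ; _/_)

record SimpleGraph (n : ℕ) : Set where
  field
    adj    : Fin n → Fin n → Bool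
    sym    : ∀ i j → adj i j ≡ adj j i
    irrefl : ∀ i → adj i i ≡ false
open SimpleGraph public

edgeCount : ∀ {n} → SimpleGraph n → ℕ
edgeCount {n} G =
  sum (map (λ i → sum (map (λ j → if (toℕ i <ᵇ toℕ j) ∧ adj G i j then 1 else 0)
                           (allFinL n)))
           (allFinL n))

addEdge : ∀ {n} → (Fin n → Fin n → Bool) → Fin n → Fin n → (Fin n → Fin n → Bool)
addEdge A i j x y = A x y ∨ (⌊ x ≟ i ⌋ ∧ ⌊ y ≟ j ⌋) ∨ (⌊ x ≟ j ⌋ ∧ ⌊ y ≟ i ⌋)

-- Vertices of the caterpillar P_5^r: the path vertices p0..p4 (Fin 5) and,
-- for each internal vertex p(k+1) (k : Fin 3), r pendant leaves (k , l).
CatVertex : ℕ → Set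
CatVertex r = Fin 5 ⊎ (Fin 3 × Fin r)

-- Edges of P_5^r (each edge listed once, in one orientation)
data CatEdge (r : ℕ) : CatVertex r → CatVertex r → Set where
  path : (k : Fin 4) → CatEdge r (inj₁ (Data.Fin.inject₁ k)) (inj₁ (Data.Fin.suc k))
  leaf : (k : Fin 3) (l : Fin r) →
         CatEdge r (inj₁ (Data.Fin.suc (Data.Fin.inject₁ k))) (inj₂ (k , l))

ContainsCat : ∀ {n} → ℕ → (Fin n → Fin n → Bool) → Set
ContainsCat {n} r A =
  Σ (CatVertex r → Fin n) λ f →
    Injective _≡_ _≡_ f × (∀ u v → CatEdge r u v → A (f u) (f v) ≡ true)

CatSaturated : ∀ {n} → ℕ → SimpleGraph n → Set
CatSaturated r G =
  ¬ ContainsCat r (adj G) ×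
  (∀ i j → i ≢ j → adj G i j ≡ false → ContainsCat r (addEdge (adj G) i j))

ℕ→ℚ : ℕ → ℚ
ℕ→ℚ n = (+ n) / 1

qOf : ℕ → ℕ
qOf s = 2 ⊔ ⌊ (s ∸ 1) /2⌋

{-# OPTIONS --safe #-}
-- Write s = k + 1 and call a vertex big if its degree is at least s + 1; the spine of a caterpillar
-- consists of three big vertices.
--
-- Lower bound. When adding xy creates a caterpillar, its spine has an edge between {x , y} and the other
-- vertices. Hence vertices of degree below s are pairwise adjacent, which costs at most (s + 1)² / 4 in the
-- degree sum, and at most one big vertex has no big neighbour. The small vertices that have no big
-- neighbour, or a single one, of degree exactly s + 1, which is also the only big neighbour of another
-- vertex, form a clique as well, so there are at most s + 1 of them. Every other small vertex takes a
-- charge of 2 in total from its big neighbours, and a big vertex keeps 2 for itself; a big vertex b then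
-- pays at most (s + 3) (deg b - s), or one more if it has no big neighbour.
--
-- Upper bound. Take double stars with s + 1 or more leaves at each centre, join the leaves by an
-- (s - 1)-regular graph with hardly any edges inside a double star, and add a clique on s + 1 vertices
-- if the residue of n requires it. Only the centres are big and no three of them form a path, but an edge added at a
-- leaf x makes x, its centre and the partner of its centre a spine.

module Submission where

open import Defs
import Data.Bool as Bool
open import Data.Bool using (Bool; true; false; _∧_; _∨_; if_then_else_)
open import Data.Bool.Properties using (∨-zeroʳ)
open import Data.Empty using (⊥; ⊥-elim)
open import Data.Fin using (Fin; zero; suc; toℕ; fromℕ; inject₁; inject≤; _≟_; _↑ˡ_; _↑ʳ_; splitAt; join; punchIn; punchOut; opposite)
import Data.Fin.Properties as Fin
open import Data.Fin.Relation.Unary.Top using (view; view-fromℕ; view-inject₁; ‵fromℕ; ‵inject₁)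
open import Data.List using (List; []; _∷_; map; allFin; tabulate; length; lookup)
open import Data.List.Membership.Propositional using (_∈_; _∉_)
open import Data.List.Membership.Propositional.Properties using (∈-map⁺)
import Data.List.Membership.DecPropositional as DecMembership
open import Data.List.Relation.Unary.Any using (here; there)
import Data.List.Relation.Unary.Any as Any
open import Data.List.Relation.Unary.Any.Properties using (lookup-index)
open import Data.List.Properties using (length-map; map-tabulate)
import Data.Nat.ListAction as ListAction
open import Data.Nat using (ℕ; zero; suc; ⌊_/2⌋; _+_; _*_; _∸_; _^_; _≤_; _<_; z≤n; s≤s; _<ᵇ_; _≤?_) renaming (_≟_ to _≟ℕ_)
open import Data.Nat.Properties hiding (_≟_)
open import Algebra.Properties.Semiring.Sum +-*-semiring using (sum; ∑-distrib-+; ∑-comm; *-distribˡ-sum; *-distribʳ-sum; sum-cong-≗)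
import Data.Nat.DivMod as ℕ
open import Data.Nat.DivMod using (_%_; m%n<n; m≡m%n+[m/n]*n)
open import Data.Nat.Tactic.RingSolver using (solve-∀)
open import Data.Product using (Σ; ∃; _×_; _,_; proj₁; proj₂)
import Data.Sum
open import Data.Sum using (_⊎_; inj₁; inj₂; [_,_]′)
import Data.Product.Properties as Product
import Data.Integer as ℤ
import Data.Integer.Properties as ℤ
open import Data.Rational using () renaming (_+_ to _+ℚ_; _*_ to _*ℚ_; _-_ to _-ℚ_; _≤_ to _≤ℚ_)
import Data.Rational as ℚ
import Data.Rational.Properties as ℚ
import Data.Rational.Unnormalised as ℚᵘ
import Data.Rational.Unnormalised.Properties as ℚᵘ
import Data.Sum.Properties as Sum
open import Function using (_∘_; id)
open import Function.Definitions using (Injective)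
open import Relation.Binary.PropositionalEquality using (_≡_; _≢_; refl; trans; cong; cong₂; subst; subst₂; module ≡-Reasoning) renaming (sym to ≡-sym)
open import Relation.Binary.Definitions using (tri<; tri≈; tri>)
open import Relation.Nullary using (¬_; Dec; yes; no; does)
open import Relation.Nullary.Decidable using (⌊_⌋; _×-dec_; _⊎-dec_; _→-dec_; ¬?; dec-true; dec-false; decidable-stable)

-- The degree sum is s n plus the surplus of degrees above s minus the deficit below s, so both
-- bounds measure how much surplus is needed per vertex. In the lower bound a unit of surplus can
-- pay s + 3. At degree s + 2 this just suffices even if every neighbour charges 2, since 2 + 2 (s +
-- 2) = 2 (s + 3). The obstacle is degree s + 1, where the budget allows only 1 per neighbour on
-- average. The remedy is that a tree has no triangle: if both ends of a spine edge have degree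
-- exactly s + 1, the tree uses all their neighbours, so they cannot have a common one. Vertices
-- that depend on the same big vertex of degree s + 1 are therefore forced to be adjacent, and the
-- triangles so created block them from reaching any tree at all. In the construction a centre has
-- degree at least s + 2, one more than a spine needs, because the other end of an edge added at a
-- leaf may be a leaf of the same centre, which the centre must then give up. A smallest double star
-- thus has 2 s + 4 vertices and surplus 4, whence the fraction 2 / (s + 2).

private
  variable
    k m n : ℕ
    U V : Set

-- Sums and counts over Fin n

ind : Bool → ℕ
ind b = if b then 1 else 0

count : (Fin n → Bool) → ℕ
count P = sum (λ i → ind (P i))

true≢false : ∀ {b} → b ≡ true → b ≡ false → ⊥
true≢false refl ()

≢true⇒false : ∀ {b} → ¬ b ≡ true → b ≡ false
≢true⇒false {true}  h = ⊥-elim (h refl)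
≢true⇒false {false} h = refl

true-ext : ∀ {a b} → (a ≡ true → b ≡ true) → (b ≡ true → a ≡ true) → a ≡ b
true-ext {true}  {b}     f g = ≡-sym (f refl)
true-ext {false} {true}  f g = g refl
true-ext {false} {false} f g = refl

does-true : ∀ {A : Set} (a? : Dec A) → does a? ≡ true → A
does-true (yes a) _ = a

ind-mono : ∀ {a b} → (a ≡ true → b ≡ true) → ind a ≤ ind b
ind-mono {true}  h rewrite h refl = ≤-refl
ind-mono {false} h = z≤n

sum-mono : {f g : Fin n → ℕ} → (∀ i → f i ≤ g i) → sum f ≤ sum g
sum-mono {zero}  h = z≤n
sum-mono {suc n} h = +-mono-≤ (h zero) (sum-mono (h ∘ suc))

sum-const : ∀ n c → sum {n} (λ _ → c) ≡ n * c
sum-const zero    c = refl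
sum-const (suc n) c = cong (c +_) (sum-const n c)

sum-zero : {f : Fin n → ℕ} → (∀ i → f i ≡ 0) → sum f ≡ 0
sum-zero {n} h = trans (sum-cong-≗ h) (trans (sum-const n 0) (*-zeroʳ n))

sum-δ : (i : Fin n) → sum (λ j → ind (does (i ≟ j))) ≡ 1
sum-δ {suc n} zero    = cong suc (sum-zero {n} (λ _ → refl))
sum-δ (suc i) = sum-δ i

sum-δ′ : (i : Fin n) → sum (λ j → ind (does (j ≟ i))) ≡ 1
sum-δ′ {suc n} zero    = cong suc (sum-zero {n} (λ _ → refl))
sum-δ′ (suc i) = sum-δ′ i

count-mono : {P Q : Fin n → Bool} → (∀ i → P i ≡ true → Q i ≡ true) → count P ≤ count Q
count-mono h = sum-mono (λ i → ind-mono (h i))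

count-∪ : {P Q R : Fin n → Bool} → (∀ i → P i ≡ true → Q i ≡ true ⊎ R i ≡ true) → count P ≤ count Q + count R
count-∪ {P = P} {Q} {R} h = ≤-trans (sum-mono pointwise) (≤-reflexive (∑-distrib-+ (ind ∘ Q) (ind ∘ R)))
  where
  pointwise : ∀ i → ind (P i) ≤ ind (Q i) + ind (R i)
  pointwise i with P i in eq
  ... | false = z≤n
  ... | true with h i eq
  ...   | inj₁ q rewrite q = s≤s z≤n
  ...   | inj₂ r rewrite r = m≤n+m 1 (ind (Q i))

count-insert : {P Q : Fin n → Bool} (y : Fin n) → (∀ i → P i ≡ true → Q i ≡ true ⊎ i ≡ y) → count P ≤ suc (count Q)
count-insert {P = P} {Q} y h = ≤-trans (count-∪ {P = P} {Q} {λ i → does (i ≟ y)} h′) (≤-reflexive (trans (cong (count Q +_) (sum-δ′ y)) (+-comm _ 1)))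
  where
  h′ : ∀ i → P i ≡ true → Q i ≡ true ⊎ does (i ≟ y) ≡ true
  h′ i p with h i p
  ... | inj₁ q = inj₁ q
  ... | inj₂ e = inj₂ (dec-true (i ≟ y) e)

count-unique : (P : Fin n → Bool) → (∀ i j → P i ≡ true → P j ≡ true → i ≡ j) → count P ≤ 1
count-unique {zero}  P h = z≤n
count-unique {suc n} P h with P zero in eq
... | true  = s≤s (≤-reflexive (sum-zero λ i → cong ind (≢true⇒false λ p → Fin.0≢1+n (h zero (suc i) eq p))))
... | false = count-unique (P ∘ suc) (λ i j p q → Fin.suc-injective (h (suc i) (suc j) p q))

-- An injection, respectively a surjection, from Fin k is compared with P by counting
-- the pairs (i , j) with f i ≡ j in two ways.

count-pairs : (f : Fin m → Fin n) → sum (λ j → count (λ i → does (f i ≟ j))) ≡ m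
count-pairs {m} f = begin
  sum (λ j → sum (λ i → ind (does (f i ≟ j)))) ≡⟨ ∑-comm (λ j i → ind (does (f i ≟ j))) ⟩
  sum (λ i → sum (λ j → ind (does (f i ≟ j)))) ≡⟨ sum-cong-≗ (λ i → sum-δ (f i)) ⟩
  sum {m} (λ _ → 1)                            ≡⟨ sum-const m 1 ⟩
  m * 1                                        ≡⟨ *-identityʳ m ⟩
  m                                            ∎
  where open ≡-Reasoning

injection⇒≤count : {P : Fin n → Bool} (f : Fin m → Fin n) → Injective _≡_ _≡_ f → (∀ i → P (f i) ≡ true) → m ≤ count P
injection⇒≤count {P = P} f inj h = ≤-trans (≤-reflexive (≡-sym (count-pairs f))) (sum-mono pointwise)
  where
  pointwise : ∀ j → count (λ i → does (f i ≟ j)) ≤ ind (P j)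
  pointwise j with P j in eq
  ... | true  = count-unique _ (λ i i′ p q → inj (trans (does-true (f i ≟ j) p) (≡-sym (does-true (f i′ ≟ j) q))))
  ... | false = ≤-reflexive (sum-zero λ i → cong ind (dec-false (f i ≟ j) λ e → true≢false (h i) (trans (cong P e) eq)))

true⇒1≤count : {P : Fin n → Bool} (i : Fin n) → P i ≡ true → 1 ≤ count P
true⇒1≤count i p = injection⇒≤count (λ (_ : Fin 1) → i) (λ { {zero} {zero} _ → refl }) (λ _ → p)

surjection⇒count≤ : {P : Fin n → Bool} (f : Fin m → Fin n) → (∀ j → P j ≡ true → ∃ λ i → f i ≡ j) → count P ≤ m
surjection⇒count≤ {P = P} f h = ≤-trans (sum-mono pointwise) (≤-reflexive (count-pairs f))
  where
  pointwise : ∀ j → ind (P j) ≤ count (λ i → does (f i ≟ j))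
  pointwise j with P j in eq
  ... | false = z≤n
  ... | true with h j eq
  ...   | i , e = true⇒1≤count i (dec-true (f i ≟ j) e)

count-tight : {P : Fin n → Bool} (f : Fin m → Fin n) → Injective _≡_ _≡_ f → (∀ i → P (f i) ≡ true) → count P ≤ m → ∀ j → P j ≡ true → ∃ λ i → f i ≡ j
count-tight {n} {m} {P} f inj h c≤m j p with Fin.any? (λ i → f i ≟ j)
... | yes hit = hit
... | no ¬hit = ⊥-elim (<-irrefl refl (≤-trans (injection⇒≤count g g-inj g-P) c≤m))
  where
  g : Fin (suc m) → Fin n
  g zero    = j
  g (suc i) = f i
  g-inj : Injective _≡_ _≡_ g
  g-inj {zero}  {zero}  e = refl
  g-inj {zero}  {suc i} e = ⊥-elim (¬hit (i , ≡-sym e))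
  g-inj {suc i} {zero}  e = ⊥-elim (¬hit (i , e))
  g-inj {suc i} {suc _} e = cong suc (inj e)
  g-P : ∀ i → P (g i) ≡ true
  g-P zero    = p
  g-P (suc i) = h i

distinct⇒2≤count : {P : Fin n → Bool} {i j : Fin n} → i ≢ j → P i ≡ true → P j ≡ true → 2 ≤ count P
distinct⇒2≤count {n} {P} {i} {j} i≢j p q = injection⇒≤count f f-inj f-P
  where
  f : Fin 2 → Fin n
  f zero       = i
  f (suc zero) = j
  f-inj : Injective _≡_ _≡_ f
  f-inj {zero}     {zero}     e = refl
  f-inj {zero}     {suc zero} e = ⊥-elim (i≢j e)
  f-inj {suc zero} {zero}     e = ⊥-elim (i≢j (≡-sym e))
  f-inj {suc zero} {suc zero} e = refl
  f-P : ∀ a → P (f a) ≡ true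
  f-P zero       = p
  f-P (suc zero) = q

2≤count⇒another : (P : Fin n → Bool) → 2 ≤ count P → ∀ i → ∃ λ j → j ≢ i × P j ≡ true
2≤count⇒another P 2≤c i with Fin.any? (λ j → ¬? (j ≟ i) ×-dec (P j Data.Bool.≟ true))
... | yes another = another
... | no ¬another = ⊥-elim (<-irrefl refl (≤-trans 2≤c (count-unique P λ j j′ p q → trans (only j p) (≡-sym (only j′ q)))))
  where
  only : ∀ j → P j ≡ true → j ≡ i
  only j p with j ≟ i
  ... | yes e = e
  ... | no ¬e = ⊥-elim (¬another (j , ¬e , p))

enumerate : (P : Fin n → Bool) → Σ (Fin (count P) → Fin n) λ f → Injective _≡_ _≡_ f × (∀ i → P (f i) ≡ true)
enumerate {zero} P = (λ ()) , (λ { {()} }) , (λ ())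
enumerate {suc n} P with enumerate (P ∘ suc) | P zero in eq
... | f , inj , h | false = suc ∘ f , (inj ∘ Fin.suc-injective) , h
... | f , inj , h | true  = g , g-inj , g-P
  where
  g : Fin (suc (count (P ∘ suc))) → Fin (suc n)
  g zero    = zero
  g (suc i) = suc (f i)
  g-inj : Injective _≡_ _≡_ g
  g-inj {zero}  {zero}  e = refl
  g-inj {suc i} {suc j} e = cong suc (inj (Fin.suc-injective e))
  g-P : ∀ i → P (g i) ≡ true
  g-P zero    = eq
  g-P (suc i) = h i

choose : {P : Fin n → Bool} → m ≤ count P → Σ (Fin m → Fin n) λ f → Injective _≡_ _≡_ f × (∀ i → P (f i) ≡ true)
choose {P = P} m≤c with enumerate P
... | f , inj , h = (λ i → f (inject≤ i m≤c)) , (λ {i} {j} e → Fin.inject≤-injective m≤c m≤c i j (inj e)) , (λ i → h (inject≤ i m≤c))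

-- Degrees

deg : SimpleGraph n → Fin n → ℕ
deg G v = count (adj G v)

sum-allFin : (f : Fin n → ℕ) → ListAction.sum (map f (allFin n)) ≡ sum f
sum-allFin f = trans (cong ListAction.sum (map-tabulate id f)) (sum-tabulate f)
  where
  sum-tabulate : ∀ {n} (f : Fin n → ℕ) → ListAction.sum (tabulate f) ≡ sum f
  sum-tabulate {zero}  f = refl
  sum-tabulate {suc n} f = cong (f zero +_) (sum-tabulate (f ∘ suc))

<ᵇ-trichotomy : ∀ a b → a ≢ b → ind (a <ᵇ b) + ind (b <ᵇ a) ≡ 1
<ᵇ-trichotomy zero    zero    h = ⊥-elim (h refl)
<ᵇ-trichotomy zero    (suc b) h = refl
<ᵇ-trichotomy (suc a) zero    h = refl
<ᵇ-trichotomy (suc a) (suc b) h = <ᵇ-trichotomy a b (h ∘ cong suc)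

handshake : (G : SimpleGraph n) → sum (deg G) ≡ 2 * edgeCount G
handshake {n} G = begin
  sum (λ i → sum (λ j → ind (adj G i j)))                   ≡⟨ sum-cong-≗ (λ i → trans (sum-cong-≗ {n} (split i)) (∑-distrib-+ (fwd i) (λ j → fwd j i))) ⟩
  sum (λ i → sum (fwd i) + sum (λ j → fwd j i))             ≡⟨ ∑-distrib-+ (λ i → sum (fwd i)) (λ i → sum (λ j → fwd j i)) ⟩
  sum (λ i → sum (fwd i)) + sum (λ i → sum (λ j → fwd j i)) ≡⟨ cong₂ _+_ fwd-edges (trans (∑-comm (λ i j → fwd j i)) fwd-edges) ⟩
  edgeCount G + edgeCount G                                 ≡⟨ cong (edgeCount G +_) (+-identityʳ _) ⟨
  2 * edgeCount G                                           ∎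
  where
  open ≡-Reasoning
  fwd : Fin n → Fin n → ℕ
  fwd i j = ind ((toℕ i <ᵇ toℕ j) ∧ adj G i j)
  fwd-edges : sum (λ i → sum (fwd i)) ≡ edgeCount G
  fwd-edges = ≡-sym (trans (sum-allFin {n} _) (sum-cong-≗ {n} (λ i → sum-allFin (fwd i))))
  ind-∧ : ∀ a b → ind (a ∧ b) ≡ ind a * ind b
  ind-∧ true  b = ≡-sym (+-identityʳ _)
  ind-∧ false b = refl
  split : ∀ i j → ind (adj G i j) ≡ fwd i j + fwd j i
  split i j rewrite sym G j i | ind-∧ (toℕ i <ᵇ toℕ j) (adj G i j) | ind-∧ (toℕ j <ᵇ toℕ i) (adj G i j)
    with adj G i j in eq
  ... | false rewrite *-zeroʳ (ind (toℕ i <ᵇ toℕ j)) = ≡-sym (*-zeroʳ (ind (toℕ j <ᵇ toℕ i)))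
  ... | true rewrite *-identityʳ (ind (toℕ i <ᵇ toℕ j)) | *-identityʳ (ind (toℕ j <ᵇ toℕ i)) =
    ≡-sym (<ᵇ-trichotomy (toℕ i) (toℕ j) λ e → true≢false (trans (cong (adj G i) (Fin.toℕ-injective e)) eq) (irrefl G i))

-- Caterpillars

internal : Fin 3 → CatVertex k
internal a = inj₁ (suc (inject₁ a))

catNbr : Fin 3 → Fin (2 + k) → CatVertex k
catNbr a zero          = inj₁ (inject₁ (inject₁ a))
catNbr a (suc zero)    = inj₁ (suc (suc a))
catNbr a (suc (suc l)) = inj₂ (a , l)

before≢after : (a : Fin 3) → inject₁ (inject₁ a) ≢ suc (suc a)
before≢after zero             ()
before≢after (suc zero)       ()
before≢after (suc (suc zero)) ()

catNbr-injective : ∀ a → Injective _≡_ _≡_ (catNbr {k} a)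
catNbr-injective a {zero}        {zero}         e = refl
catNbr-injective a {zero}        {suc zero}     e = ⊥-elim (before≢after a (Sum.inj₁-injective e))
catNbr-injective a {suc zero}    {zero}         e = ⊥-elim (before≢after a (≡-sym (Sum.inj₁-injective e)))
catNbr-injective a {suc zero}    {suc zero}     e = refl
catNbr-injective a {suc (suc l)} {suc (suc l′)} e = cong (λ x → suc (suc x)) (Product.,-injectiveʳ (Sum.inj₂-injective e))

-- Both orientations occur, since a spine edge may leave the ends of the added edge in either
-- direction.
data Consecutive : Fin 3 → Fin 3 → Set where
  c₀₁ : Consecutive zero (suc zero)
  c₁₀ : Consecutive (suc zero) zero
  c₁₂ : Consecutive (suc zero) (suc (suc zero))
  c₂₁ : Consecutive (suc (suc zero)) (suc zero)

-- Consecutive internal vertices lie on different sides of the bipartition of the tree.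
catNbr-disjoint : ∀ {a b} → Consecutive a b → ∀ i j → catNbr {k} a i ≢ catNbr b j
catNbr-disjoint {k} {a} {b} c i j e = differ c (trans (≡-sym (side-catNbr a i)) (trans (cong side e) (side-catNbr b j)))
  where
  middle : Fin 3 → Bool
  middle zero             = false
  middle (suc zero)       = true
  middle (suc (suc zero)) = false
  side : CatVertex k → Bool
  side (inj₁ zero)                         = false
  side (inj₁ (suc zero))                   = true
  side (inj₁ (suc (suc zero)))             = false
  side (inj₁ (suc (suc (suc zero))))       = true
  side (inj₁ (suc (suc (suc (suc zero))))) = false
  side (inj₂ (a , _))                      = middle a
  side-catNbr : ∀ a i → side (catNbr a i) ≡ middle a
  side-catNbr zero             zero          = refl
  side-catNbr (suc zero)       zero          = refl
  side-catNbr (suc (suc zero)) zero          = refl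
  side-catNbr zero             (suc zero)    = refl
  side-catNbr (suc zero)       (suc zero)    = refl
  side-catNbr (suc (suc zero)) (suc zero)    = refl
  side-catNbr a                (suc (suc _)) = refl
  differ : ∀ {a b} → Consecutive a b → middle a ≢ middle b
  differ c₀₁ ()
  differ c₁₀ ()
  differ c₁₂ ()
  differ c₂₁ ()

module Caterpillar {A : Fin n → Fin n → Bool} (A-sym : ∀ i j → A i j ≡ A j i) (C : ContainsCat k A) where

  f : CatVertex k → Fin n
  f = proj₁ C

  f-injective : Injective _≡_ _≡_ f
  f-injective = proj₁ (proj₂ C)

  spine : Fin 3 → Fin n
  spine a = f (internal a)

  spine-injective : Injective _≡_ _≡_ spine
  spine-injective e = Fin.inject₁-injective (Fin.suc-injective (Sum.inj₁-injective (f-injective e)))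

  f-catNbr : ∀ a i → A (spine a) (f (catNbr a i)) ≡ true
  f-catNbr a zero          = trans (A-sym _ _) (proj₂ (proj₂ C) _ _ (path (inject₁ a)))
  f-catNbr a (suc zero)    = proj₂ (proj₂ C) _ _ (path (suc a))
  f-catNbr a (suc (suc l)) = proj₂ (proj₂ C) _ _ (leaf a l)

  f-catNbr-injective : ∀ a → Injective _≡_ _≡_ (λ i → f (catNbr a i))
  f-catNbr-injective a = catNbr-injective a ∘ f-injective

  spine-degree : ∀ a → 2 + k ≤ count (A (spine a))
  spine-degree a = injection⇒≤count (f ∘ catNbr a) (f-catNbr-injective a) (f-catNbr a)

  consecutive-adjacent : ∀ {a b} → Consecutive a b → A (spine a) (spine b) ≡ true
  consecutive-adjacent c₀₁ = f-catNbr zero (suc zero)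
  consecutive-adjacent c₁₀ = f-catNbr (suc zero) zero
  consecutive-adjacent c₁₂ = f-catNbr (suc zero) (suc zero)
  consecutive-adjacent c₂₁ = f-catNbr (suc (suc zero)) zero

  -- When consecutive spine vertices have no spare degree, all their neighbours belong to the tree.
  no-common-neighbour : ∀ {a b} → Consecutive a b → count (A (spine a)) ≤ 2 + k → count (A (spine b)) ≤ 2 + k →
    ∀ z → A (spine a) z ≡ true → A (spine b) z ≡ true → ⊥
  no-common-neighbour {a} {b} c da db z az bz
    with count-tight (f ∘ catNbr a) (f-catNbr-injective a) (f-catNbr a) da z az
       | count-tight (f ∘ catNbr b) (f-catNbr-injective b) (f-catNbr b) db z bz
  ... | i , e | j , e′ = catNbr-disjoint c i j (f-injective (trans e (≡-sym e′)))

-- Adding an edge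

module AddEdge (A : Fin n → Fin n → Bool) (A-sym : ∀ i j → A i j ≡ A j i) (x y : Fin n) where

  A⁺ : Fin n → Fin n → Bool
  A⁺ = addEdge A x y

  ⌊≟⌋-true : ∀ {i j : Fin n} → ⌊ i ≟ j ⌋ ≡ true → i ≡ j
  ⌊≟⌋-true {i} {j} h with i ≟ j
  ... | yes e = e

  ⌊≟⌋-refl : ∀ (i : Fin n) → ⌊ i ≟ i ⌋ ≡ true
  ⌊≟⌋-refl i with i ≟ i
  ... | yes _ = refl
  ... | no ¬e = ⊥-elim (¬e refl)

  A⁺-cases : ∀ {u v} → A⁺ u v ≡ true → A u v ≡ true ⊎ (u ≡ x × v ≡ y) ⊎ (u ≡ y × v ≡ x)
  A⁺-cases {u} {v} h with A u v
  ... | true  = inj₁ refl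
  ... | false with ⌊ u ≟ x ⌋ in ux | ⌊ v ≟ y ⌋ in vy | ⌊ u ≟ y ⌋ in uy | ⌊ v ≟ x ⌋ in vx
  ... | true  | true  | _     | _     = inj₂ (inj₁ (⌊≟⌋-true ux , ⌊≟⌋-true vy))
  ... | true  | false | true  | true  = inj₂ (inj₂ (⌊≟⌋-true uy , ⌊≟⌋-true vx))
  ... | false | true  | true  | true  = inj₂ (inj₂ (⌊≟⌋-true uy , ⌊≟⌋-true vx))
  ... | false | false | true  | true  = inj₂ (inj₂ (⌊≟⌋-true uy , ⌊≟⌋-true vx))

  A⇒A⁺ : ∀ {u v} → A u v ≡ true → A⁺ u v ≡ true
  A⇒A⁺ h rewrite h = refl

  A⁺-xy : A⁺ x y ≡ true
  A⁺-xy rewrite ⌊≟⌋-refl x | ⌊≟⌋-refl y = ∨-zeroʳ (A x y)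

  A⁺-yx : A⁺ y x ≡ true
  A⁺-yx rewrite ⌊≟⌋-refl x | ⌊≟⌋-refl y = trans (cong (A y x ∨_) (∨-zeroʳ _)) (∨-zeroʳ (A y x))

  A⁺-sym : ∀ i j → A⁺ i j ≡ A⁺ j i
  A⁺-sym i j = true-ext flip flip
    where
    flip : ∀ {i j} → A⁺ i j ≡ true → A⁺ j i ≡ true
    flip {i} {j} h with A⁺-cases h
    ... | inj₁ a                    = A⇒A⁺ (trans (A-sym j i) a)
    ... | inj₂ (inj₁ (refl , refl)) = A⁺-yx
    ... | inj₂ (inj₂ (refl , refl)) = A⁺-xy

  Touched : Fin n → Set
  Touched v = v ≡ x ⊎ v ≡ y

  touched? : ∀ v → Dec (Touched v)
  touched? v = (v ≟ x) ⊎-dec (v ≟ y)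

  A⁺-untouched : ∀ {u v} → ¬ Touched u → A⁺ u v ≡ true → A u v ≡ true
  A⁺-untouched ¬t h with A⁺-cases h
  ... | inj₁ a              = a
  ... | inj₂ (inj₁ (e , _)) = ⊥-elim (¬t (inj₁ e))
  ... | inj₂ (inj₂ (e , _)) = ⊥-elim (¬t (inj₂ e))

  degree-untouched : ∀ {u} → ¬ Touched u → count (A⁺ u) ≤ count (A u)
  degree-untouched {u} ¬t = count-mono {P = A⁺ u} (λ v → A⁺-untouched ¬t)

  degree-touched : x ≢ y → ∀ {u} → Touched u → count (A⁺ u) ≤ suc (count (A u))
  degree-touched x≢y (inj₁ refl) = count-insert {P = A⁺ x} y λ v h → [ inj₁ , [ inj₂ ∘ proj₂ , ⊥-elim ∘ x≢y ∘ proj₁ ]′ ]′ (A⁺-cases h)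
  degree-touched x≢y (inj₂ refl) = count-insert {P = A⁺ y} x λ v h → [ inj₁ , [ ⊥-elim ∘ x≢y ∘ ≡-sym ∘ proj₁ , inj₂ ∘ proj₂ ]′ ]′ (A⁺-cases h)

  -- Every edge of the tree has a spine endpoint, so a tree whose spine avoids x and y lies in A already;
  -- and the spine does not fit into {x , y}.
  spine-crosses : ¬ ContainsCat k A → (C : ContainsCat k A⁺) → let open Caterpillar A⁺-sym C in
    (∀ {a b} → Consecutive a b → Touched (spine a) → Touched (spine b)) → ⊥
  spine-crosses {k} free C closed with touched? (Caterpillar.spine A⁺-sym C zero)
  ... | yes t₀ = inside t₀ (closed c₀₁ t₀) (closed c₁₂ (closed c₀₁ t₀))
    where
    open Caterpillar A⁺-sym C
    same : ∀ {a b z} → a ≢ b → spine a ≡ z → spine b ≡ z → ⊥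
    same a≢b e e′ = a≢b (spine-injective (trans e (≡-sym e′)))
    inside : Touched (spine zero) → Touched (spine (suc zero)) → Touched (spine (suc (suc zero))) → ⊥
    inside (inj₁ p) (inj₁ q) _        = same (λ ()) p q
    inside (inj₂ p) (inj₂ q) _        = same (λ ()) p q
    inside (inj₁ p) (inj₂ q) (inj₁ r) = same (λ ()) p r
    inside (inj₁ p) (inj₂ q) (inj₂ r) = same (λ ()) q r
    inside (inj₂ p) (inj₁ q) (inj₁ r) = same (λ ()) q r
    inside (inj₂ p) (inj₁ q) (inj₂ r) = same (λ ()) p r
  ... | no ¬t₀ = free (f , f-injective , edges)
    where
    open Caterpillar A⁺-sym C
    ¬t₁ : ¬ Touched (spine (suc zero))
    ¬t₁ = ¬t₀ ∘ closed c₁₀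
    ¬t : ∀ a → ¬ Touched (spine a)
    ¬t zero             = ¬t₀
    ¬t (suc zero)       = ¬t₁
    ¬t (suc (suc zero)) = ¬t₁ ∘ closed c₂₁
    old : ∀ a i → A (spine a) (f (catNbr a i)) ≡ true
    old a i = A⁺-untouched (¬t a) (f-catNbr a i)
    edges : ∀ u v → CatEdge k u v → A (f u) (f v) ≡ true
    edges _ _ (path zero)                   = trans (A-sym _ _) (old zero zero)
    edges _ _ (path (suc zero))             = old zero (suc zero)
    edges _ _ (path (suc (suc zero)))       = old (suc zero) (suc zero)
    edges _ _ (path (suc (suc (suc zero)))) = old (suc (suc zero)) (suc zero)
    edges _ _ (leaf a l)                    = old a (suc (suc l))

-- The lower bound

-- The inequality of arithmetic and geometric means. With `t` equal to s + 1 and `m` vertices of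
-- degree below s it yields the summand (s + 1)² / 8 of the first constant.
4*m*[t∸m]≤t² : ∀ m t → 4 * (m * (t ∸ m)) ≤ t ^ 2
4*m*[t∸m]≤t² m t with ≤-total m t
... | inj₂ t≤m rewrite m≤n⇒m∸n≡0 t≤m | *-zeroʳ m = z≤n
... | inj₁ m≤t = subst (λ u → 4 * (m * (t ∸ m)) ≤ u ^ 2) (m+[n∸m]≡n m≤t) (am-gm m (t ∸ m))
  where
  open ≤-Reasoning
  ordered : ∀ a c → 4 * (a * (a + c)) ≤ (a + (a + c)) ^ 2
  ordered a c = begin
    4 * (a * (a + c))         ≤⟨ m≤m+n _ (c * c) ⟩
    4 * (a * (a + c)) + c * c ≡⟨ identity a c ⟩
    (a + (a + c)) ^ 2         ∎
    where
    identity : ∀ a c → 4 * (a * (a + c)) + c * c ≡ (a + (a + c)) * ((a + (a + c)) * 1)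
    identity = solve-∀
  am-gm : ∀ a b → 4 * (a * b) ≤ (a + b) ^ 2
  am-gm a b with ≤-total a b
  ... | inj₁ a≤b = subst (λ b → 4 * (a * b) ≤ (a + b) ^ 2) (m+[n∸m]≡n a≤b) (ordered a (b ∸ a))
  ... | inj₂ b≤a = subst₂ (λ p q → 4 * p ≤ q ^ 2) (*-comm b a) (+-comm b a)
                     (subst (λ a → 4 * (b * a) ≤ (b + a) ^ 2) (m+[n∸m]≡n b≤a) (ordered b (a ∸ b)))

-- Both sides are the maximum of `a` and `b`. Summed over all degrees with `b` equal to `s`, this
-- relates surplus and deficit without negative numbers.
∸-exchange : ∀ a b → (a ∸ b) + b ≡ a + (b ∸ a)
∸-exchange a b with ≤-total a b
... | inj₁ a≤b rewrite m≤n⇒m∸n≡0 a≤b | m+[n∸m]≡n a≤b = refl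
... | inj₂ b≤a rewrite m≤n⇒m∸n≡0 b≤a | m∸n+n≡m b≤a = ≡-sym (+-identityʳ a)

module LowerBound (G : SimpleGraph n) (sat : CatSaturated k G) where

  private
    s : ℕ
    s = suc k
    A : Fin n → Fin n → Bool
    A = adj G
    d : Fin n → ℕ
    d = deg G

  Big : Fin n → Set
  Big v = suc s ≤ d v

  big? : ∀ v → Dec (Big v)
  big? v = suc s ≤? d v

  -- For nonadjacent `x` and `y` saturation supplies a tree, and `spine-crosses` a spine edge from
  -- `x` or `y` to a third vertex. All structure in the lower bound is obtained by ruling out such
  -- an edge.
  adjacent-unless-crossed : ∀ {x y} → x ≢ y →
    let open AddEdge A (sym G) x y in
    (∀ (C : ContainsCat k A⁺) {a b} → Consecutive a b →
      let open Caterpillar A⁺-sym C in Touched (spine a) → ¬ Touched (spine b) → ⊥) →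
    A x y ≡ true
  adjacent-unless-crossed {x} {y} x≢y uncrossed with A x y in eq
  ... | true  = refl
  ... | false = ⊥-elim (spine-crosses (proj₁ sat) C λ {a} {b} c t → decidable-stable (touched? _) (uncrossed C c t))
    where
    open AddEdge A (sym G) x y
    C : ContainsCat k A⁺
    C = proj₂ sat x y x≢y eq

  -- Even with the added edge the degree is at most `s`, one less than a spine vertex needs.
  low-clique : ∀ {x y} → d x < s → d y < s → x ≢ y → A x y ≡ true
  low-clique {x} {y} x-low y-low x≢y = adjacent-unless-crossed x≢y λ C {a} _ t _ →
    <-irrefl refl (≤-trans (Caterpillar.spine-degree A⁺-sym C a) (≤-trans (degree-touched x≢y t) (touched-low t)))
    where
    open AddEdge A (sym G) x y
    touched-low : ∀ {u} → Touched u → suc (d u) ≤ s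
    touched-low (inj₁ refl) = x-low
    touched-low (inj₂ refl) = y-low

  Isolated : Fin n → Set
  Isolated b = Big b × (∀ c → A b c ≡ true → ¬ Big c)

  isolated? : ∀ b → Dec (Isolated b)
  isolated? b = big? b ×-dec Fin.all? (λ c → (A b c Bool.≟ true) →-dec ¬? (big? c))

  -- A third vertex on the spine keeps its degree, so it was big before; next to `x` or `y` it would
  -- be a big neighbour of an isolated vertex. Hence distinct isolated vertices would be adjacent,
  -- but they are big themselves.
  isolated-unique : ∀ {x y} → Isolated x → Isolated y → x ≡ y
  isolated-unique {x} {y} (_ , x-isolated) (y-big , y-isolated) with x ≟ y
  ... | yes e   = e
  ... | no x≢y = ⊥-elim (x-isolated y (adjacent-unless-crossed x≢y uncrossed) y-big)
    where
    open AddEdge A (sym G) x y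
    touched-isolated : ∀ {u} → Touched u → ∀ c → A u c ≡ true → ¬ Big c
    touched-isolated (inj₁ refl) = x-isolated
    touched-isolated (inj₂ refl) = y-isolated
    uncrossed : ∀ (C : ContainsCat k A⁺) {a b} → Consecutive a b →
      let open Caterpillar A⁺-sym C in Touched (spine a) → ¬ Touched (spine b) → ⊥
    uncrossed C {a} {b} c t ¬t = touched-isolated t (spine b)
      (trans (sym G _ _) (A⁺-untouched ¬t (trans (A⁺-sym _ _) (consecutive-adjacent c))))
      (≤-trans (spine-degree b) (degree-untouched ¬t))
      where open Caterpillar A⁺-sym C

  -- Such a big neighbour b of x cannot follow x on the spine after adding xy:
  -- neither has spare degree, but they share a neighbour.
  Blocked : Fin n → Fin n → Set
  Blocked x y = ∀ b → A x b ≡ true → Big b →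
    d b ≤ suc s × ∃ λ z → A b z ≡ true × (z ≡ y ⊎ A x z ≡ true)

  blocked-adjacent : ∀ {x y} → x ≢ y → d x ≤ s → d y ≤ s → Blocked x y → Blocked y x → A x y ≡ true
  blocked-adjacent {x} {y} x≢y x-small y-small x-blocked y-blocked = adjacent-unless-crossed x≢y uncrossed
    where
    open AddEdge A (sym G) x y
    module _ (C : ContainsCat k A⁺) where
      open Caterpillar A⁺-sym C
      step : ∀ {u v a b} → Consecutive a b → spine a ≡ u → Touched u → A⁺ u v ≡ true → d u ≤ s → Blocked u v → ¬ Touched (spine b) → ⊥
      step {u} {v} {a} {b} c refl t uv u-small u-blocked ¬t
        with u-blocked (spine b) (trans (sym G _ _) (A⁺-untouched ¬t (trans (A⁺-sym _ _) (consecutive-adjacent c))))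
                                 (≤-trans (spine-degree b) (degree-untouched ¬t))
      -- With the added edge `u` has degree at most `suc s`, which is the tree degree `2 + k`, and
      -- so has `spine b`. The vertex `z` is adjacent to both: if it is the far end `v`, then to `u`
      -- by the added edge.
      ... | b≤ , z , bz , common = no-common-neighbour c
              (≤-trans (degree-touched x≢y t) (s≤s u-small)) (≤-trans (degree-untouched ¬t) b≤)
              z ([ (λ e → subst (λ w → A⁺ u w ≡ true) (≡-sym e) uv) , A⇒A⁺ ]′ common) (A⇒A⁺ bz)
      uncrossed : ∀ {a b} → Consecutive a b → Touched (spine a) → ¬ Touched (spine b) → ⊥
      uncrossed c (inj₁ e) = step c e (inj₁ refl) A⁺-xy x-small x-blocked
      uncrossed c (inj₂ e) = step c e (inj₂ refl) A⁺-yx y-small y-blocked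

  bigNbr? : ∀ x b → Dec (A x b ≡ true × Big b)
  bigNbr? x b = (A x b Bool.≟ true) ×-dec big? b

  bigDeg : Fin n → ℕ
  bigDeg x = count (λ b → does (bigNbr? x b))

  bigNbr-unique : ∀ {x b c} → bigDeg x ≡ 1 → A x b ≡ true × Big b → A x c ≡ true × Big c → b ≡ c
  bigNbr-unique {x} {b} {c} one p q with b ≟ c
  ... | yes e  = e
  ... | no b≢c = ⊥-elim (<-irrefl refl (≤-trans (distinct⇒2≤count b≢c (dec-true (bigNbr? x b) p) (dec-true (bigNbr? x c) q)) (≤-reflexive one)))

  -- For a big `b` these are the small vertices whose only big neighbour is `b`.
  Private : Fin n → Fin n → Set
  Private b x = A b x ≡ true × d x ≤ s × bigDeg x ≡ 1

  private? : ∀ b x → Dec (Private b x)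
  private? b x = (A b x Bool.≟ true) ×-dec (d x ≤? s) ×-dec (bigDeg x ≟ℕ 1)

  privates : Fin n → ℕ
  privates b = count (λ x → does (private? b x))

  -- Each of the two vertices could be followed on a spine only by `b`, and together with the added
  -- edge they form a triangle with `b`.
  private-clique : ∀ {b x y} → d b ≡ suc s → Private b x → Private b y → x ≢ y → A x y ≡ true
  private-clique {b} b-tight x-private@(_ , x-small , _) y-private@(_ , y-small , _) x≢y =
    blocked-adjacent x≢y x-small y-small (block x-private y-private) (block y-private x-private)
    where
    block : ∀ {u v} → Private b u → Private b v → Blocked u v
    block {u} {v} (bu , _ , one) (bv , _) c uc c-big
      rewrite bigNbr-unique one (uc , c-big) (trans (sym G u b) bu , ≤-reflexive (≡-sym b-tight)) =
      ≤-reflexive b-tight , v , bv , inj₁ refl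

  -- The small vertices that are not charged to a big neighbour.
  Confined : Fin n → Set
  Confined x = d x ≤ s × (∀ b → A x b ≡ true × Big b → bigDeg x ≡ 1 × d b ≡ suc s × 2 ≤ privates b)

  confined? : ∀ x → Dec (Confined x)
  confined? x = (d x ≤? s) ×-dec Fin.all? (λ b → bigNbr? x b →-dec ((bigDeg x ≟ℕ 1) ×-dec (d b ≟ℕ suc s) ×-dec (2 ≤? privates b)))

  -- Only big neighbours can follow a confined `u` on the spine. Such a `b` has a second private
  -- neighbour `z`, adjacent to `u` by `private-clique`, so the triangle `u`, `b`, `z` blocks the
  -- edge whatever the other end of the added edge is.
  confined-clique : ∀ {x y} → Confined x → Confined y → x ≢ y → A x y ≡ true
  confined-clique x-confined@(x-small , _) y-confined@(y-small , _) x≢y =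
    blocked-adjacent x≢y x-small y-small (block x-confined) (block y-confined)
    where
    block : ∀ {u v} → Confined u → Blocked u v
    block {u} (u-small , confine) b ub b-big with confine b (ub , b-big)
    ... | one , b-tight , many with 2≤count⇒another (λ x → does (private? b x)) many u
    ...   | z , z≢u , z-private = ≤-reflexive b-tight , z , proj₁ zp , inj₂ (private-clique b-tight (trans (sym G b u) ub , u-small , one) zp (z≢u ∘ ≡-sym))
      where
      zp : Private b z
      zp = does-true (private? b z) z-private

  -- A clique lies in the closed neighbourhood of each of its members, and here a member has degree
  -- at most `s`.
  confined-few : count (λ x → does (confined? x)) ≤ suc s
  confined-few with Fin.any? confined?
  ... | no none = ≤-trans (≤-reflexive (sum-zero {n} λ x → cong ind (dec-false (confined? x) λ c → none (x , c)))) z≤n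
  ... | yes (x , x-confined@(x-small , _)) = ≤-trans (count-insert x covered) (s≤s x-small)
    where
    covered : ∀ z → does (confined? z) ≡ true → A x z ≡ true ⊎ z ≡ x
    covered z h with z ≟ x
    ... | yes e  = inj₂ e
    ... | no z≢x = inj₁ (confined-clique x-confined (does-true (confined? z) h) (z≢x ∘ ≡-sym))

  -- The charge that `x` places on each of its big neighbours. The index is the amount, so a match
  -- on `weigh x` gives the value together with its reason.
  data Weight (x : Fin n) : ℕ → Set where
    big      : Big x → Weight x 0
    confined : Confined x → Weight x 0
    single   : d x ≤ s → ¬ Confined x → bigDeg x ≡ 1 → Weight x 2
    shared   : d x ≤ s → ¬ Confined x → bigDeg x ≢ 1 → Weight x 1

  weigh : ∀ x → ∃ (Weight x)
  weigh x with big? x | confined? x | bigDeg x ≟ℕ 1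
  ... | yes b | _     | _      = 0 , big b
  ... | no ¬b | yes c | _      = 0 , confined c
  ... | no ¬b | no ¬c | yes e  = 2 , single (≤-pred (≰⇒> ¬b)) ¬c e
  ... | no ¬b | no ¬c | no ¬e  = 1 , shared (≤-pred (≰⇒> ¬b)) ¬c ¬e

  weight : Fin n → ℕ
  weight x = proj₁ (weigh x)

  charged : ∀ x → 2 ≤ 2 * ind (does (confined? x)) + (2 * ind (does (big? x)) + bigDeg x * weight x)
  charged x with weigh x
  ... | .0 , big b rewrite dec-true (big? x) b = m≤n⇒m≤o+n (2 * ind (does (confined? x))) (s≤s (s≤s z≤n))
  ... | .0 , confined c rewrite dec-true (confined? x) c = s≤s (s≤s z≤n)
  ... | .2 , single _ _ e = m≤n⇒m≤o+n (2 * ind (does (confined? x))) (m≤n⇒m≤o+n (2 * ind (does (big? x))) (≤-reflexive (cong (_* 2) (≡-sym e))))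
  ... | .1 , shared x-small ¬c ¬e = m≤n⇒m≤o+n (2 * ind (does (confined? x))) (m≤n⇒m≤o+n (2 * ind (does (big? x)))
          (subst (2 ≤_) (≡-sym (*-identityʳ _)) (≤∧≢⇒< 1≤bigDeg (¬e ∘ ≡-sym))))
    where
    1≤bigDeg : 1 ≤ bigDeg x
    1≤bigDeg with Fin.any? (bigNbr? x)
    ... | yes (b , h) = true⇒1≤count b (dec-true (bigNbr? x b) h)
    -- A small vertex without big neighbours is confined vacuously; therefore a `shared` vertex has
    -- at least two of them, and charges of 1 add up to 2.
    ... | no none     = ⊥-elim (¬c (x-small , λ b h → ⊥-elim (none (b , h))))

  load : Fin n → ℕ
  load b = sum (λ x → ind (A b x) * weight x)

  load≤2d : ∀ b → load b ≤ d b + d b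
  load≤2d b = ≤-trans (sum-mono pointwise) (≤-reflexive (∑-distrib-+ (ind ∘ A b) (ind ∘ A b)))
    where
    pointwise : ∀ x → ind (A b x) * weight x ≤ ind (A b x) + ind (A b x)
    pointwise x with A b x | weigh x
    ... | false | _                 = z≤n
    ... | true  | .0 , big _        = z≤n
    ... | true  | .0 , confined _   = z≤n
    ... | true  | .2 , single _ _ _ = ≤-refl
    ... | true  | .1 , shared _ _ _ = s≤s z≤n

  -- A neighbour that would charge 2 has `b` as its only big neighbour, and the two hypotheses on
  -- `b` then make it confined.
  load≤d : ∀ {b} → d b ≡ suc s → 2 ≤ privates b → load b ≤ d b
  load≤d {b} b-tight many = sum-mono pointwise
    where
    pointwise : ∀ x → ind (A b x) * weight x ≤ ind (A b x)
    pointwise x with A b x in bx | weigh x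
    ... | false | _                       = z≤n
    ... | true  | .0 , big _              = z≤n
    ... | true  | .0 , confined _         = z≤n
    ... | true  | .1 , shared _ _ _       = ≤-refl
    ... | true  | .2 , single x-small ¬c e = ⊥-elim (¬c (x-small , λ c h →
            e , subst (λ c → d c ≡ suc s × 2 ≤ privates c)
                  (bigNbr-unique e (trans (sym G x b) bx , ≤-reflexive (≡-sym b-tight)) h) (b-tight , many)))

  -- A big neighbour of b is counted in d b but puts no load on b.
  load-bound : ∀ b (extra : Fin n → Bool) → (∀ x → extra x ≡ true → A b x ≡ true × Big x) →
    load b + count extra ≤ d b + privates b
  load-bound b extra extra-big = begin
    load b + count extra                                                ≡⟨ ∑-distrib-+ (λ x → ind (A b x) * weight x) (ind ∘ extra) ⟨
    sum (λ x → ind (A b x) * weight x + ind (extra x))                  ≤⟨ sum-mono pointwise ⟩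
    sum (λ x → ind (A b x) + ind (does (private? b x)))                 ≡⟨ ∑-distrib-+ (ind ∘ A b) (λ x → ind (does (private? b x))) ⟩
    d b + privates b                                                    ∎
    where
    open ≤-Reasoning
    not-extra : ∀ {x} → d x ≤ s → ind (extra x) ≡ 0
    not-extra {x} x-small with extra x in eq
    ... | false = refl
    ... | true  = ⊥-elim (<-irrefl refl (≤-trans (proj₂ (extra-big x eq)) x-small))
    ind-double : ∀ {p q} → (p ≡ true → q ≡ true) → ind p * 2 ≤ ind p + ind q
    ind-double {true}  h rewrite h refl = ≤-refl
    ind-double {false} h = z≤n
    extra≤ : ∀ x → ind (extra x) ≤ ind (A b x)
    extra≤ x = ind-mono (proj₁ ∘ extra-big x)
    pointwise : ∀ x → ind (A b x) * weight x + ind (extra x) ≤ ind (A b x) + ind (does (private? b x))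
    pointwise x with weigh x
    ... | .0 , big _              rewrite *-zeroʳ (ind (A b x)) = ≤-trans (extra≤ x) (m≤m+n _ _)
    ... | .0 , confined _         rewrite *-zeroʳ (ind (A b x)) = ≤-trans (extra≤ x) (m≤m+n _ _)
    ... | .1 , shared x-small _ _ rewrite not-extra x-small | *-identityʳ (ind (A b x)) | +-identityʳ (ind (A b x)) = m≤m+n _ _
    ... | .2 , single x-small _ e rewrite not-extra x-small | +-identityʳ (ind (A b x) * 2) =
            ind-double (λ bx → dec-true (private? b x) (bx , x-small , e))

  -- At degree s + 2 + j the charge is at most twice the degree, and 2 + 2 (s + 2 + j) is at most (s
  -- + 3) (2 + j). At degree s + 1 the load may only be s + 1. With two private neighbours nothing
  -- charges more than 1. With at most one, the load can exceed the degree by 1; a big neighbour,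
  -- which charges nothing, makes up for it, and without one `b` is isolated and the extra unit is
  -- granted.
  discharged : ∀ b → Big b → 2 + load b ≤ (s + 3) * (d b ∸ s) + ind (does (isolated? b))
  discharged b b-big with d b ≟ℕ suc s
  ... | no ¬tight = ≤-trans (+-monoʳ-≤ 2 (load≤2d b)) (m≤n⇒m≤n+o _ spare)
    where
    open ≤-Reasoning
    j : ℕ
    j = d b ∸ suc (suc s)
    d≡ : suc (suc s) + j ≡ d b
    d≡ = m+[n∸m]≡n (≤∧≢⇒< b-big (¬tight ∘ ≡-sym))
    identity : ∀ s j → (s + 3) * (2 + j) ≡ 2 + ((suc (suc s) + j) + (suc (suc s) + j)) + (s + 1) * j
    identity = solve-∀
    spare : 2 + (d b + d b) ≤ (s + 3) * (d b ∸ s)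
    spare = begin
      2 + (d b + d b)                                                 ≡⟨ cong (λ t → 2 + (t + t)) d≡ ⟨
      2 + ((suc (suc s) + j) + (suc (suc s) + j))                     ≤⟨ m≤m+n _ ((s + 1) * j) ⟩
      2 + ((suc (suc s) + j) + (suc (suc s) + j)) + (s + 1) * j       ≡⟨ identity s j ⟨
      (s + 3) * (2 + j)                                               ≡⟨ cong ((s + 3) *_) (m+n∸n≡m (2 + j) s) ⟨
      (s + 3) * ((2 + j) + s ∸ s)                                     ≡⟨ cong (λ t → (s + 3) * (t ∸ s)) (trans (trans (+-comm (2 + j) s) (trans (≡-sym (+-assoc s 2 j)) (cong (_+ j) (+-comm s 2)))) d≡) ⟩
      (s + 3) * (d b ∸ s)                                             ∎
  ... | yes tight = subst (λ t → 2 + load b ≤ t + ind (does (isolated? b))) (≡-sym one-unit) bound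
    where
    open ≤-Reasoning
    one-unit : (s + 3) * (d b ∸ s) ≡ s + 3
    one-unit = trans (cong ((s + 3) *_) (trans (cong (_∸ s) tight) (m+n∸n≡m 1 s))) (*-identityʳ (s + 3))
    bound : 2 + load b ≤ s + 3 + ind (does (isolated? b))
    bound with 2 ≤? privates b
    ... | yes many = begin
      2 + load b                               ≤⟨ +-monoʳ-≤ 2 (≤-trans (load≤d tight many) (≤-reflexive tight)) ⟩
      3 + s                                    ≡⟨ +-comm 3 s ⟩
      s + 3                                    ≤⟨ m≤m+n _ _ ⟩
      s + 3 + ind (does (isolated? b))         ∎
    ... | no few with Fin.any? (bigNbr? b)
    ...   | yes (c , bc , c-big) = begin
      2 + load b                                   ≡⟨ cong suc (+-comm 1 (load b)) ⟩
      1 + (load b + 1)                             ≡⟨ cong (λ t → 1 + (load b + t)) (sum-δ′ c) ⟨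
      1 + (load b + count (λ x → does (x ≟ c)))    ≤⟨ s≤s (load-bound b (λ x → does (x ≟ c)) λ x h → subst (λ x → A b x ≡ true × Big x) (≡-sym (does-true (x ≟ c) h)) (bc , c-big)) ⟩
      1 + (d b + privates b)                       ≤⟨ s≤s (+-mono-≤ (≤-reflexive tight) (≤-pred (≰⇒> few))) ⟩
      2 + s + 1                                    ≡⟨ cong (_+ 1) (+-comm 2 s) ⟩
      s + 2 + 1                                    ≡⟨ +-assoc s 2 1 ⟩
      s + 3                                        ≤⟨ m≤m+n _ _ ⟩
      s + 3 + ind (does (isolated? b))             ∎
    ...   | no none = begin
      2 + load b                                   ≤⟨ +-monoʳ-≤ 2 (m+n≤o⇒m≤o (load b) (load-bound b (λ _ → false) (λ _ ()))) ⟩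
      2 + (d b + privates b)                       ≤⟨ +-monoʳ-≤ 2 (+-mono-≤ (≤-reflexive tight) (≤-pred (≰⇒> few))) ⟩
      3 + s + 1                                    ≡⟨ cong (_+ 1) (+-comm 3 s) ⟩
      s + 3 + 1                                    ≡⟨ cong (λ t → s + 3 + ind t) (dec-true (isolated? b) (b-big , λ c bc c-big → none (c , bc , c-big))) ⟨
      s + 3 + ind (does (isolated? b))             ∎

  surplus deficit : ℕ
  surplus = sum (λ v → d v ∸ s)
  deficit = sum (λ v → s ∸ d v)

  -- Every vertex accounts for 2, and exchanging the order of summation books each charge at the big
  -- vertex that receives it. The confined vertices contribute `2 * suc s` and the isolated vertex
  -- 1; together these are the 2 s + 3 in the numerator of the first constant.
  surplus-bound : n * 2 ≤ 2 * suc s + ((s + 3) * surplus + 1)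
  surplus-bound = begin
    n * 2                                                   ≡⟨ sum-const n 2 ⟨
    sum {n} (λ _ → 2)                                       ≤⟨ sum-mono charged ⟩
    sum (λ x → cf x + (bg x + bigDeg x * weight x))         ≡⟨ ∑-distrib-+ cf (λ x → bg x + bigDeg x * weight x) ⟩
    sum cf + sum (λ x → bg x + bigDeg x * weight x)         ≡⟨ cong (sum cf +_) (∑-distrib-+ bg (λ x → bigDeg x * weight x)) ⟩
    sum cf + (sum bg + sum (λ x → bigDeg x * weight x))     ≡⟨ cong (λ t → sum cf + (sum bg + t)) double-count ⟩
    sum cf + (sum bg + sum (λ b → ind (does (big? b)) * load b)) ≡⟨ cong (sum cf +_) (∑-distrib-+ bg (λ b → ind (does (big? b)) * load b)) ⟨
    sum cf + sum (λ b → bg b + ind (does (big? b)) * load b)     ≤⟨ +-mono-≤ cf≤ (sum-mono pay) ⟩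
    2 * suc s + sum (λ b → (s + 3) * (d b ∸ s) + ind (does (isolated? b))) ≡⟨ cong ((2 * suc s) +_) (∑-distrib-+ (λ b → (s + 3) * (d b ∸ s)) (λ b → ind (does (isolated? b)))) ⟩
    2 * suc s + (sum (λ b → (s + 3) * (d b ∸ s)) + count (λ b → does (isolated? b))) ≤⟨ +-monoʳ-≤ (2 * suc s) (+-mono-≤ (≤-reflexive (≡-sym (*-distribˡ-sum (s + 3) (λ b → d b ∸ s)))) one-isolated) ⟩
    2 * suc s + ((s + 3) * surplus + 1)                     ∎
    where
    open ≤-Reasoning
    cf bg : Fin n → ℕ
    cf x = 2 * ind (does (confined? x))
    bg x = 2 * ind (does (big? x))
    cf≤ : sum cf ≤ 2 * suc s
    cf≤ = ≤-trans (≤-reflexive (≡-sym (*-distribˡ-sum 2 (λ x → ind (does (confined? x)))))) (*-monoʳ-≤ 2 confined-few)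
    one-isolated : count (λ b → does (isolated? b)) ≤ 1
    one-isolated = count-unique _ (λ i j p q → isolated-unique (does-true (isolated? i) p) (does-true (isolated? j) q))
    pay : ∀ b → bg b + ind (does (big? b)) * load b ≤ (s + 3) * (d b ∸ s) + ind (does (isolated? b))
    pay b = paid (big? b) (discharged b)
      where
      paid : ∀ {P : Set} (p? : Dec P) {l t} → (P → 2 + l ≤ t) → 2 * ind (does p?) + ind (does p?) * l ≤ t
      paid (yes p) {l} h = subst (λ l′ → 2 + l′ ≤ _) (≡-sym (+-identityʳ l)) (h p)
      paid (no _)      h = z≤n
    pair : ∀ x b → ind (does (bigNbr? x b)) * weight x ≡ ind (does (big? b)) * (ind (A b x) * weight x)
    pair x b rewrite sym G x b = ind-swap (A b x) (does (big? b)) (weight x)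
      where
      ind-swap : ∀ p q w → ind (does (p Bool.≟ true) ∧ q) * w ≡ ind q * (ind p * w)
      ind-swap true  true  w = ≡-sym (+-identityʳ _)
      ind-swap true  false w = refl
      ind-swap false true  w = refl
      ind-swap false false w = refl
    double-count : sum (λ x → bigDeg x * weight x) ≡ sum (λ b → ind (does (big? b)) * load b)
    double-count = begin-equality
      sum (λ x → bigDeg x * weight x)                                          ≡⟨ sum-cong-≗ {n} (λ x → *-distribʳ-sum (weight x) (λ b → ind (does (bigNbr? x b)))) ⟩
      sum (λ x → sum (λ b → ind (does (bigNbr? x b)) * weight x))              ≡⟨ ∑-comm (λ x b → ind (does (bigNbr? x b)) * weight x) ⟩
      sum (λ b → sum (λ x → ind (does (bigNbr? x b)) * weight x))              ≡⟨ sum-cong-≗ {n} (λ b → sum-cong-≗ {n} (λ x → pair x b)) ⟩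
      sum (λ b → sum (λ x → ind (does (big? b)) * (ind (A b x) * weight x)))   ≡⟨ sum-cong-≗ {n} (λ b → *-distribˡ-sum (ind (does (big? b))) (λ x → ind (A b x) * weight x)) ⟨
      sum (λ b → ind (does (big? b)) * load b)                                 ∎

  -- The vertices of degree below `s` form a clique. If there are m of them, each has degree at
  -- least m - 1, hence is short of `s` by at most s + 1 - m.
  deficit-bound : 4 * deficit ≤ suc s ^ 2
  deficit-bound = ≤-trans (*-monoʳ-≤ 4 deficit≤) (4*m*[t∸m]≤t² lows (suc s))
    where
    open ≤-Reasoning
    low? : ∀ v → Dec (d v < s)
    low? v = suc (d v) ≤? s
    lows : ℕ
    lows = count (λ v → does (low? v))
    lows≤ : ∀ {v} → d v < s → lows ≤ suc (d v)
    lows≤ {v} v-low = count-insert v covered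
      where
      covered : ∀ z → does (low? z) ≡ true → A v z ≡ true ⊎ z ≡ v
      covered z h with z ≟ v
      ... | yes e  = inj₂ e
      ... | no z≢v = inj₁ (low-clique v-low (does-true (low? z) h) (z≢v ∘ ≡-sym))
    pointwise : ∀ v → s ∸ d v ≤ ind (does (low? v)) * (suc s ∸ lows)
    pointwise v = dominated (low? v) (λ v-low → ∸-monoʳ-≤ (suc s) (lows≤ v-low)) (λ ¬low → m≤n⇒m∸n≡0 (≮⇒≥ ¬low))
      where
      dominated : ∀ {P : Set} (p? : Dec P) {l t} → (P → l ≤ t) → (¬ P → l ≡ 0) → l ≤ ind (does p?) * t
      dominated (yes p) h _ = ≤-trans (h p) (≤-reflexive (≡-sym (+-identityʳ _)))
      dominated (no ¬p) _ h = ≤-reflexive (h ¬p)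
    deficit≤ : deficit ≤ lows * (suc s ∸ lows)
    deficit≤ = ≤-trans (sum-mono pointwise) (≤-reflexive (≡-sym (*-distribʳ-sum (suc s ∸ lows) (λ v → ind (does (low? v))))))

  -- This is the lower bound of the theorem multiplied by 8 (s + 3).
  edges-bound : 4 * ((s * (s + 3) + 2) * n) ≤ 8 * ((s + 3) * edgeCount G) + (4 * (2 * s + 3) + (s + 3) * suc s ^ 2)
  edges-bound = begin
    4 * ((s * (s + 3) + 2) * n)                                                 ≡⟨ expand s n ⟩
    4 * ((s + 3) * (n * s)) + 4 * (n * 2)                                       ≤⟨ +-monoʳ-≤ (4 * ((s + 3) * (n * s))) (*-monoʳ-≤ 4 surplus-bound) ⟩
    4 * ((s + 3) * (n * s)) + 4 * (2 * suc s + ((s + 3) * surplus + 1))         ≡⟨ regroup s n surplus ⟩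
    4 * ((s + 3) * (surplus + n * s)) + 4 * (2 * s + 3)                         ≡⟨ cong (λ t → 4 * ((s + 3) * t) + 4 * (2 * s + 3)) balance ⟩
    4 * ((s + 3) * (2 * edgeCount G + deficit)) + 4 * (2 * s + 3)               ≡⟨ separate s (edgeCount G) deficit ⟩
    8 * ((s + 3) * edgeCount G) + (4 * (2 * s + 3) + (s + 3) * (4 * deficit))   ≤⟨ +-monoʳ-≤ (8 * ((s + 3) * edgeCount G)) (+-monoʳ-≤ (4 * (2 * s + 3)) (*-monoʳ-≤ (s + 3) deficit-bound)) ⟩
    8 * ((s + 3) * edgeCount G) + (4 * (2 * s + 3) + (s + 3) * suc s ^ 2)       ∎
    where
    open ≤-Reasoning
    expand : ∀ s n → 4 * ((s * (s + 3) + 2) * n) ≡ 4 * ((s + 3) * (n * s)) + 4 * (n * 2)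
    expand = solve-∀
    regroup : ∀ s n x → 4 * ((s + 3) * (n * s)) + 4 * (2 * suc s + ((s + 3) * x + 1)) ≡ 4 * ((s + 3) * (x + n * s)) + 4 * (2 * s + 3)
    regroup = solve-∀
    separate : ∀ s e y → 4 * ((s + 3) * (2 * e + y)) + 4 * (2 * s + 3) ≡ 8 * ((s + 3) * e) + (4 * (2 * s + 3) + (s + 3) * (4 * y))
    separate = solve-∀
    balance : surplus + n * s ≡ 2 * edgeCount G + deficit
    balance = begin-equality
      surplus + n * s                   ≡⟨ cong (surplus +_) (sum-const n s) ⟨
      surplus + sum {n} (λ _ → s)       ≡⟨ ∑-distrib-+ (λ v → d v ∸ s) (λ _ → s) ⟨
      sum (λ v → (d v ∸ s) + s)         ≡⟨ sum-cong-≗ {n} (λ v → ∸-exchange (d v) s) ⟩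
      sum (λ v → d v + (s ∸ d v))       ≡⟨ ∑-distrib-+ d (λ v → s ∸ d v) ⟩
      sum d + deficit                   ≡⟨ cong (_+ deficit) (handshake G) ⟩
      2 * edgeCount G + deficit         ∎

-- Building caterpillars

count-except : {P Q : Fin n → Bool} (E : List (Fin n)) → (∀ i → P i ≡ true → Q i ≡ true ⊎ i ∈ E) → count P ≤ length E + count Q
count-except {n} {P} {Q} E h = ≤-trans (count-∪ {P = P} {λ i → does (i ∈? E)} {Q} h′) (+-monoˡ-≤ (count Q) (surjection⇒count≤ (lookup E) hit))
  where
  open DecMembership (_≟_ {n}) using (_∈?_)
  h′ : ∀ i → P i ≡ true → does (i ∈? E) ≡ true ⊎ Q i ≡ true
  h′ i p = [ inj₂ , inj₁ ∘ dec-true (i ∈? E) ]′ (h i p)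
  hit : ∀ j → does (j ∈? E) ≡ true → ∃ λ i → lookup E i ≡ j
  hit j h = Any.index j∈E , ≡-sym (lookup-index j∈E)
    where
    j∈E : j ∈ E
    j∈E = does-true (j ∈? E) h

-- Leaves of the tree at each spine vertex; the two ends of the path count as leaves.
leaves : ℕ → Fin 3 → ℕ
leaves k zero             = suc k
leaves k (suc zero)       = k
leaves k (suc (suc zero)) = suc k

-- `E a` lists the vertices that must not become leaves at `spine a`. As a common neighbour of two
-- spine vertices is forbidden at one of them, the leaves can be chosen at each spine vertex
-- independently and are disjoint nevertheless. Forbidding a vertex costs one unit of degree, which
-- is what `enough` provides for.
module Build {A : Fin n → Fin n → Bool} (A-sym : ∀ i j → A i j ≡ A j i) (spine : Fin 3 → Fin n) (spine-injective : Injective _≡_ _≡_ spine)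
  (A₀₁ : A (spine zero) (spine (suc zero)) ≡ true) (A₁₂ : A (spine (suc zero)) (spine (suc (suc zero))) ≡ true)
  (E : Fin 3 → List (Fin n))
  (enough : ∀ a → length (E a) + leaves k a ≤ count (A (spine a)))
  (off-spine : ∀ a b → A (spine a) (spine b) ≡ true → spine b ∈ E a)
  (disjoint : ∀ {a b z} → a Data.Fin.< b → A (spine a) z ≡ true → A (spine b) z ≡ true → z ∈ E a ⊎ z ∈ E b)
  where

  open DecMembership (_≟_ {n}) using (_∈?_)

  private
    free? : ∀ a z → Dec (A (spine a) z ≡ true × z ∉ E a)
    free? a z = (A (spine a) z Bool.≟ true) ×-dec ¬? (z ∈? E a)

    enough-free : ∀ a → leaves k a ≤ count (λ z → does (free? a z))
    enough-free a = +-cancelˡ-≤ (length (E a)) _ _ (≤-trans (enough a) (count-except (E a) split))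
      where
      split : ∀ z → A (spine a) z ≡ true → does (free? a z) ≡ true ⊎ z ∈ E a
      split z h = decide (z ∈? E a)
        where
        decide : Dec (z ∈ E a) → does (free? a z) ≡ true ⊎ z ∈ E a
        decide (yes z∈E) = inj₂ z∈E
        decide (no z∉E)  = inj₁ (dec-true (free? a z) (h , z∉E))

    choice : ∀ a → Σ (Fin (leaves k a) → Fin n) λ f → Injective _≡_ _≡_ f × (∀ i → does (free? a (f i)) ≡ true)
    choice a = choose {P = λ z → does (free? a z)} (enough-free a)

    pick : ∀ a → Fin (leaves k a) → Fin n
    pick a = proj₁ (choice a)

    pick-injective : ∀ a → Injective _≡_ _≡_ (pick a)
    pick-injective a = proj₁ (proj₂ (choice a))

    pick-free : ∀ a i → A (spine a) (pick a i) ≡ true × pick a i ∉ E a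
    pick-free a i = does-true (free? a (pick a i)) (proj₂ (proj₂ (choice a)) i)

    apart : ∀ {a b i j} → a Data.Fin.< b → pick a i ≢ pick b j
    apart {a} {b} {i} {j} a<b e with pick-free a i | pick-free b j
    ... | ai , i∉ | bj , j∉ = [ i∉ , (λ h → j∉ (subst (_∈ E b) e h)) ]′ (disjoint a<b ai (subst (λ z → A (spine b) z ≡ true) (≡-sym e) bj))

    -- Separating spine and leaves, with the path ends among the leaves, reduces injectivity of the
    -- embedding to the pairs of these two sorts.
    Code : Set
    Code = Fin 3 ⊎ Σ (Fin 3) (λ a → Fin (leaves k a))

    place : Code → Fin n
    place (inj₁ a)       = spine a
    place (inj₂ (a , i)) = pick a i

    place-injective : ∀ {u v} → place u ≡ place v → u ≡ v
    place-injective {inj₁ a}       {inj₁ b}       e = cong inj₁ (spine-injective e)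
    place-injective {inj₁ a}       {inj₂ (b , j)} e with pick-free b j
    ... | bj , j∉ = ⊥-elim (j∉ (subst (_∈ E b) e (off-spine b a (subst (λ z → A (spine b) z ≡ true) (≡-sym e) bj))))
    place-injective {inj₂ (a , i)} {inj₁ b}       e with pick-free a i
    ... | ai , i∉ = ⊥-elim (i∉ (subst (_∈ E a) (≡-sym e) (off-spine a b (subst (λ z → A (spine a) z ≡ true) e ai))))
    place-injective {inj₂ (a , i)} {inj₂ (b , j)} e with Fin.<-cmp a b
    ... | tri≈ _ refl _ = cong (λ i → inj₂ (a , i)) (pick-injective a e)
    ... | tri< a<b _ _  = ⊥-elim (apart a<b e)
    ... | tri> _ _ b<a  = ⊥-elim (apart b<a (≡-sym e))

    encode : CatVertex k → Code
    encode (inj₁ zero)                         = inj₂ (zero , zero)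
    encode (inj₁ (suc zero))                   = inj₁ zero
    encode (inj₁ (suc (suc zero)))             = inj₁ (suc zero)
    encode (inj₁ (suc (suc (suc zero))))       = inj₁ (suc (suc zero))
    encode (inj₁ (suc (suc (suc (suc zero))))) = inj₂ (suc (suc zero) , zero)
    encode (inj₂ (zero , l))                   = inj₂ (zero , suc l)
    encode (inj₂ (suc zero , l))               = inj₂ (suc zero , l)
    encode (inj₂ (suc (suc zero) , l))         = inj₂ (suc (suc zero) , suc l)

    decode : Code → CatVertex k
    decode (inj₁ a)                          = internal a
    decode (inj₂ (zero , zero))              = inj₁ zero
    decode (inj₂ (zero , suc l))             = inj₂ (zero , l)
    decode (inj₂ (suc zero , l))             = inj₂ (suc zero , l)
    decode (inj₂ (suc (suc zero) , zero))    = inj₁ (suc (suc (suc (suc zero))))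
    decode (inj₂ (suc (suc zero) , suc l))   = inj₂ (suc (suc zero) , l)

    decode-encode : ∀ u → decode (encode u) ≡ u
    decode-encode (inj₁ zero)                         = refl
    decode-encode (inj₁ (suc zero))                   = refl
    decode-encode (inj₁ (suc (suc zero)))             = refl
    decode-encode (inj₁ (suc (suc (suc zero))))       = refl
    decode-encode (inj₁ (suc (suc (suc (suc zero))))) = refl
    decode-encode (inj₂ (zero , l))                   = refl
    decode-encode (inj₂ (suc zero , l))               = refl
    decode-encode (inj₂ (suc (suc zero) , l))         = refl

    edges : ∀ u v → CatEdge k u v → A (place (encode u)) (place (encode v)) ≡ true
    edges _ _ (path zero)                   = trans (A-sym _ _) (proj₁ (pick-free zero zero))
    edges _ _ (path (suc zero))             = A₀₁
    edges _ _ (path (suc (suc zero)))       = A₁₂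
    edges _ _ (path (suc (suc (suc zero)))) = proj₁ (pick-free (suc (suc zero)) zero)
    edges _ _ (leaf zero l)                 = proj₁ (pick-free zero (suc l))
    edges _ _ (leaf (suc zero) l)           = proj₁ (pick-free (suc zero) l)
    edges _ _ (leaf (suc (suc zero)) l)     = proj₁ (pick-free (suc (suc zero)) (suc l))

  caterpillar : ContainsCat k A
  caterpillar = place ∘ encode , injective , edges
    where
    injective : Injective _≡_ _≡_ (place ∘ encode)
    injective {u} {v} e = trans (≡-sym (decode-encode u)) (trans (cong decode (place-injective e)) (decode-encode v))

[_,_,_] : {X : Set} → X → X → X → Fin 3 → X
[ x , y , z ] zero             = x
[ x , y , z ] (suc zero)       = y
[ x , y , z ] (suc (suc zero)) = z

build : {A : Fin n → Fin n → Bool} → (∀ i j → A i j ≡ A j i) → (∀ i → A i i ≡ false) →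
  {p q r : Fin n} → p ≢ q → p ≢ r → q ≢ r → A p q ≡ true → A q r ≡ true →
  (P Q R : List (Fin n)) →
  length P + suc k ≤ count (A p) → length Q + k ≤ count (A q) → length R + suc k ≤ count (A r) →
  q ∈ P → (A p r ≡ true → r ∈ P) → p ∈ Q → r ∈ Q → q ∈ R → (A p r ≡ true → p ∈ R) →
  (∀ {z} → A p z ≡ true → A q z ≡ true → z ∈ P ⊎ z ∈ Q) →
  (∀ {z} → A p z ≡ true → A r z ≡ true → z ∈ P ⊎ z ∈ R) →
  (∀ {z} → A q z ≡ true → A r z ≡ true → z ∈ Q ⊎ z ∈ R) →
  ContainsCat k A
build {k = k} {A = A} A-sym A-irr {p} {q} {r} p≢q p≢r q≢r pq qr P Q R P≤ Q≤ R≤ qP rP pQ rQ qR pR dPQ dPR dQR =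
  Build.caterpillar A-sym [ p , q , r ] inj pq qr [ P , Q , R ] enough off disj
  where
  inj : Injective _≡_ _≡_ [ p , q , r ]
  inj {zero}           {zero}           e = refl
  inj {zero}           {suc zero}       e = ⊥-elim (p≢q e)
  inj {zero}           {suc (suc zero)} e = ⊥-elim (p≢r e)
  inj {suc zero}       {zero}           e = ⊥-elim (p≢q (≡-sym e))
  inj {suc zero}       {suc zero}       e = refl
  inj {suc zero}       {suc (suc zero)} e = ⊥-elim (q≢r e)
  inj {suc (suc zero)} {zero}           e = ⊥-elim (p≢r (≡-sym e))
  inj {suc (suc zero)} {suc zero}       e = ⊥-elim (q≢r (≡-sym e))
  inj {suc (suc zero)} {suc (suc zero)} e = refl
  enough : ∀ a → length ([ P , Q , R ] a) + leaves k a ≤ count (A ([ p , q , r ] a))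
  enough zero             = P≤
  enough (suc zero)       = Q≤
  enough (suc (suc zero)) = R≤
  off : ∀ a b → A ([ p , q , r ] a) ([ p , q , r ] b) ≡ true → [ p , q , r ] b ∈ [ P , Q , R ] a
  off zero             zero             h = ⊥-elim (true≢false h (A-irr p))
  off zero             (suc zero)       h = qP
  off zero             (suc (suc zero)) h = rP h
  off (suc zero)       zero             h = pQ
  off (suc zero)       (suc zero)       h = ⊥-elim (true≢false h (A-irr q))
  off (suc zero)       (suc (suc zero)) h = rQ
  off (suc (suc zero)) zero             h = pR (trans (A-sym p r) h)
  off (suc (suc zero)) (suc zero)       h = qR
  off (suc (suc zero)) (suc (suc zero)) h = ⊥-elim (true≢false h (A-irr r))
  disj : ∀ {a b z} → a Data.Fin.< b → A ([ p , q , r ] a) z ≡ true → A ([ p , q , r ] b) z ≡ true → z ∈ [ P , Q , R ] a ⊎ z ∈ [ P , Q , R ] b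
  disj {zero}           {suc zero}       _ = dPQ
  disj {zero}           {suc (suc zero)} _ = dPR
  disj {suc zero}       {suc (suc zero)} _ = dQR
  disj {suc zero}       {suc zero}       (s≤s ())
  disj {suc (suc zero)} {suc zero}       (s≤s ())
  disj {suc (suc zero)} {suc (suc zero)} (s≤s (s≤s ()))

-- Double stars with edges between leaves

data Kind (V : Set) : Set where
  centre : (partner : V) → Kind V
  leaf   : (parent : V) → Kind V
  block  : Kind V

-- The properties from which saturation follows, for any vertex type, so that they can be checked on
-- structured vertices and then moved to `Fin n`. In `leaf-common` the list holds the common
-- neighbours of a leaf and its centre. Beyond it and the `k` pendant vertices of a middle spine
-- vertex, the 3 leaves room for the leaf itself, the partner and the other end of the added edge.
record DoubleStars {V : Set} (k : ℕ) (Adj : V → V → Set) (degree : V → ℕ) : Set where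
  field
    kind            : V → Kind V
    centre-adjacent : ∀ {u v} → kind u ≡ centre v → Adj u v
    centre-sym      : ∀ {u v} → kind u ≡ centre v → kind v ≡ centre u
    centre-degree   : ∀ {u v} → kind u ≡ centre v → 3 + k ≤ degree u
    centre-only     : ∀ {u v w z} → kind u ≡ centre v → kind w ≡ centre z → Adj u w → w ≡ v
    leaf-adjacent   : ∀ {x c} → kind x ≡ leaf c → Adj x c
    leaf-centre     : ∀ {x c} → kind x ≡ leaf c → ∃ λ v → kind c ≡ centre v
    leaf-degree     : ∀ {x c} → kind x ≡ leaf c → degree x ≡ suc k
    leaf-only       : ∀ {x c w z} → kind x ≡ leaf c → kind w ≡ centre z → Adj x w → w ≡ c
    leaf-common     : ∀ {x c} → kind x ≡ leaf c → Σ (List V) λ E →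
                        3 + k + length E ≤ degree c × (∀ {z} → Adj x z → Adj c z → z ∈ E)
    leaf-far        : ∀ {x c v z} → kind x ≡ leaf c → kind c ≡ centre v → Adj x z → Adj v z → z ≡ c
    block-degree    : ∀ {x} → kind x ≡ block → degree x ≡ suc k
    block-clique    : ∀ {x y} → kind x ≡ block → kind y ≡ block → x ≢ y → Adj x y
    block-centre    : ∀ {x u v} → kind x ≡ block → kind u ≡ centre v → Adj x u → ⊥
    block-far       : ∀ {x u v z} → kind x ≡ block → kind u ≡ centre v → Adj x z → Adj u z → ⊥

module Saturation (G : SimpleGraph n) (stars : DoubleStars k (λ u v → adj G u v ≡ true) (deg G)) where

  open DoubleStars stars

  private
    A : Fin n → Fin n → Bool
    A = adj G

    adjacent⇒≢ : ∀ {u v} → A u v ≡ true → u ≢ v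
    adjacent⇒≢ {u} h refl = true≢false h (irrefl G u)

    kind-≢ : ∀ {u v a b} → kind u ≡ a → kind v ≡ b → a ≢ b → u ≢ v
    kind-≢ p q a≢b refl = a≢b (trans (≡-sym p) q)

  -- A vertex of any kind has at most one centre among its neighbours.
  centres-disjoint : ∀ {u v w z x} → kind u ≡ centre v → kind w ≡ centre z → u ≢ w → A u x ≡ true → A w x ≡ true → ⊥
  centres-disjoint {u} {v} {w} {z} {x} ku kw u≢w ux wx with kind x in kx
  ... | centre y = u≢w (trans (centre-only kx ku (trans (sym G x u) ux)) (≡-sym (centre-only kx kw (trans (sym G x w) wx))))
  ... | leaf c   = u≢w (trans (leaf-only kx ku (trans (sym G x u) ux)) (≡-sym (leaf-only kx kw (trans (sym G x w) wx))))
  ... | block    = block-centre kx ku (trans (sym G x u) ux)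

  big⇒centre : ∀ {u} → 2 + k ≤ deg G u → ∃ λ v → kind u ≡ centre v
  big⇒centre {u} big with kind u in ku
  ... | centre v = v , refl
  ... | leaf c   = ⊥-elim (<-irrefl refl (≤-trans big (≤-reflexive (leaf-degree ku))))
  ... | block    = ⊥-elim (<-irrefl refl (≤-trans big (≤-reflexive (block-degree ku))))

  -- All spine vertices are centres by their degree, and the middle one would be adjacent to two
  -- centres.
  cat-free : ¬ ContainsCat k A
  cat-free C with big⇒centre (spine-degree zero) | big⇒centre (spine-degree (suc zero)) | big⇒centre (spine-degree (suc (suc zero)))
    where open Caterpillar (sym G) C
  ... | _ , k₀ | _ , k₁ | _ , k₂ = absurd (spine-injective (trans (centre-only k₁ k₀ (consecutive-adjacent c₁₀)) (≡-sym (centre-only k₁ k₂ (consecutive-adjacent c₁₂)))))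
    where
    open Caterpillar (sym G) C
    absurd : ¬ (Fin.zero {2} ≡ suc (suc zero))
    absurd ()

  module _ {x y : Fin n} (x≢y : x ≢ y) (xy : A x y ≡ false) where

    open AddEdge A (sym G) x y

    private
      A⁺-irr : ∀ i → A⁺ i i ≡ false
      A⁺-irr i = ≢true⇒false (λ h → [ (λ a → true≢false a (irrefl G i)) ,
        [ (λ { (e , e′) → x≢y (trans (≡-sym e) e′) }) , (λ { (e , e′) → x≢y (trans (≡-sym e′) e) }) ]′ ]′ (A⁺-cases h))

      deg≤ : ∀ u → deg G u ≤ count (A⁺ u)
      deg≤ u = count-mono {P = A u} (λ _ → A⇒A⁺)

      A⁺-other : ∀ {u v} → u ≢ x → u ≢ y → A⁺ u v ≡ true → A u v ≡ true
      A⁺-other u≢x u≢y = A⁺-untouched [ u≢x , u≢y ]′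

      A⁺-x : ∀ {v} → A⁺ x v ≡ true → A x v ≡ true ⊎ v ≡ y
      A⁺-x h = [ inj₁ , [ inj₂ ∘ proj₂ , ⊥-elim ∘ x≢y ∘ proj₁ ]′ ]′ (A⁺-cases h)

      A⁺-y : ∀ {v} → A⁺ y v ≡ true → A y v ≡ true ⊎ v ≡ x
      A⁺-y h = [ inj₁ , [ ⊥-elim ∘ x≢y ∘ ≡-sym ∘ proj₁ , inj₂ ∘ proj₂ ]′ ]′ (A⁺-cases h)

      deg< : suc (deg G x) ≤ count (A⁺ x)
      deg< = subst (_≤ count (A⁺ x)) (trans (∑-distrib-+ (λ z → ind (does (z ≟ y))) (ind ∘ A x)) (cong (_+ deg G x) (sum-δ′ y))) (sum-mono pointwise)
        where
        pointwise : ∀ z → ind (does (z ≟ y)) + ind (A x z) ≤ ind (A⁺ x z)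
        pointwise z = decide (z ≟ y)
          where
          decide : (z≟y : Dec (z ≡ y)) → ind (does z≟y) + ind (A x z) ≤ ind (A⁺ x z)
          decide (no _)     = ind-mono A⇒A⁺
          decide (yes refl) = ≤-reflexive (trans (cong (suc ∘ ind) xy) (cong ind (≡-sym A⁺-xy)))

    -- The spine is `x`, `c`, `v` with `v` the partner of `c`. With the added edge `x` has exactly
    -- the tree degree, so apart from `c` all its neighbours must serve as its leaves. Every
    -- conflict is therefore resolved at `c` or `v`, which give up `y` and the neighbours shared
    -- with `x`.
    leaf-cat : ∀ {c} → kind x ≡ leaf c → kind c ≢ centre y → ContainsCat k A⁺
    leaf-cat {c} kx c≢ with leaf-centre kx | leaf-common kx
    ... | v , kc | E , E≤ , common = build A⁺-sym A⁺-irr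
          (adjacent⇒≢ xc) x≢v (adjacent⇒≢ cv) (A⇒A⁺ xc) (A⇒A⁺ cv)
          (c ∷ []) (x ∷ v ∷ y ∷ E) (c ∷ y ∷ [])
          (≤-trans (s≤s (≤-reflexive (≡-sym (leaf-degree kx)))) deg<)
          (≤-trans (≤-reflexive (cong (3 +_) (+-comm (length E) k))) (≤-trans E≤ (deg≤ c)))
          (≤-trans (centre-degree (centre-sym kc)) (deg≤ v))
          (here refl) (⊥-elim ∘ ¬xv) (here refl) (there (here refl)) (here refl) (⊥-elim ∘ ¬xv)
          (λ xz cz → inj₂ ([ (λ xz → there (there (there (common xz (Ac cz))))) , (λ e → there (there (here e))) ]′ (A⁺-x xz)))
          (λ xz vz → [ (λ xz → inj₁ (here (leaf-far kx kc xz (Av vz)))) , (λ e → inj₂ (there (here e))) ]′ (A⁺-x xz))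
          (λ cz vz → ⊥-elim (centres-disjoint kc (centre-sym kc) (adjacent⇒≢ cv) (Ac cz) (Av vz)))
      where
      xc : A x c ≡ true
      xc = leaf-adjacent kx
      cv : A c v ≡ true
      cv = centre-adjacent kc
      x≢v : x ≢ v
      x≢v = kind-≢ kx (centre-sym kc) (λ ())
      v≢y : v ≢ y
      v≢y e = c≢ (trans kc (cong centre e))
      Ac : ∀ {z} → A⁺ c z ≡ true → A c z ≡ true
      Ac = A⁺-other (adjacent⇒≢ xc ∘ ≡-sym) (λ e → true≢false xc (trans (cong (A x) e) xy))
      Av : ∀ {z} → A⁺ v z ≡ true → A v z ≡ true
      Av = A⁺-other (x≢v ∘ ≡-sym) v≢y
      ¬xv : ¬ A⁺ x v ≡ true
      ¬xv h = [ (λ a → adjacent⇒≢ cv (≡-sym (leaf-only kx (centre-sym kc) a))) , v≢y ]′ (A⁺-x h)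

    -- When `y` is the partner itself, an end `x` of the spine would lack a leaf, because both `c`
    -- and `y` lie on the spine. So `x` becomes the middle vertex, where `k` leaves suffice, and the
    -- spine is `c`, `x`, `y`.
    leaf-partner-cat : ∀ {c} → kind x ≡ leaf c → kind c ≡ centre y → ContainsCat k A⁺
    leaf-partner-cat {c} kx kc with leaf-common kx
    ... | E , E≤ , common = build A⁺-sym A⁺-irr
          (adjacent⇒≢ xc ∘ ≡-sym) (adjacent⇒≢ cy) x≢y (A⇒A⁺ (trans (sym G c x) xc)) A⁺-xy
          (x ∷ y ∷ E) (c ∷ y ∷ []) (x ∷ c ∷ [])
          (≤-trans (≤-reflexive (cong (2 +_) (trans (+-suc (length E) k) (cong suc (+-comm (length E) k))))) (≤-trans E≤ (deg≤ c)))
          (≤-trans (s≤s (≤-reflexive (≡-sym (leaf-degree kx)))) deg<)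
          (≤-trans (centre-degree (centre-sym kc)) (deg≤ y))
          (here refl) (λ _ → there (here refl)) (here refl) (there (here refl)) (here refl) (λ _ → there (here refl))
          (λ cz xz → [ (λ xz → inj₁ (there (there (common xz (Ac cz))))) , (λ e → inj₂ (there (here e))) ]′ (A⁺-x xz))
          (λ cz yz → [ (λ yz → ⊥-elim (centres-disjoint kc (centre-sym kc) (adjacent⇒≢ cy) (Ac cz) yz)) , (λ e → inj₁ (here e)) ]′ (A⁺-y yz))
          (λ xz yz → [ (λ xz → [ (λ yz → inj₂ (there (here (leaf-far kx kc xz yz)))) , (λ e → inj₂ (here e)) ]′ (A⁺-y yz)) , (λ e → inj₁ (there (here e))) ]′ (A⁺-x xz))
      where
      xc : A x c ≡ true
      xc = leaf-adjacent kx
      cy : A c y ≡ true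
      cy = centre-adjacent kc
      Ac : ∀ {z} → A⁺ c z ≡ true → A c z ≡ true
      Ac = A⁺-other (adjacent⇒≢ xc ∘ ≡-sym) (adjacent⇒≢ cy)

    -- The spine is `x`, `y` and the partner of `y`. Distinct centres have no common neighbours in
    -- the old graph, so only spine vertices have to be avoided.
    centre-cat : ∀ {u v} → kind x ≡ centre u → kind y ≡ centre v → ContainsCat k A⁺
    centre-cat {u} {v} kx ky = build A⁺-sym A⁺-irr
        x≢y x≢v (adjacent⇒≢ yv) A⁺-xy (A⇒A⁺ yv)
        (y ∷ v ∷ []) (x ∷ v ∷ []) (x ∷ y ∷ [])
        (≤-trans (centre-degree kx) (deg≤ x))
        (≤-trans (m≤n+m (2 + k) 1) (≤-trans (centre-degree ky) (deg≤ y)))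
        (≤-trans (centre-degree (centre-sym ky)) (deg≤ v))
        (here refl) (λ _ → there (here refl)) (here refl) (there (here refl)) (there (here refl)) (λ _ → here refl)
        (λ xz yz → [ (λ xz → [ ⊥-elim ∘ centres-disjoint kx ky x≢y xz , (λ e → inj₂ (here e)) ]′ (A⁺-y yz)) , (λ e → inj₁ (here e)) ]′ (A⁺-x xz))
        (λ xz vz → [ (λ xz → ⊥-elim (centres-disjoint kx (centre-sym ky) x≢v xz (Av vz))) , (λ e → inj₁ (here e)) ]′ (A⁺-x xz))
        (λ yz vz → [ (λ yz → ⊥-elim (centres-disjoint ky (centre-sym ky) (adjacent⇒≢ yv) yz (Av vz))) , (λ e → inj₁ (here e)) ]′ (A⁺-y yz))
      where
      yv : A y v ≡ true
      yv = centre-adjacent ky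
      x≢v : x ≢ v
      x≢v refl = true≢false yv (trans (sym G y x) xy)
      Av : ∀ {z} → A⁺ v z ≡ true → A v z ≡ true
      Av = A⁺-other (x≢v ∘ ≡-sym) (adjacent⇒≢ yv ∘ ≡-sym)

    block-cat : ∀ {v} → kind x ≡ block → kind y ≡ centre v → ContainsCat k A⁺
    block-cat {v} kx ky = build A⁺-sym A⁺-irr
        x≢y x≢v (adjacent⇒≢ yv) A⁺-xy (A⇒A⁺ yv)
        (y ∷ []) (x ∷ v ∷ []) (x ∷ y ∷ [])
        (≤-trans (s≤s (≤-reflexive (≡-sym (block-degree kx)))) deg<)
        (≤-trans (m≤n+m (2 + k) 1) (≤-trans (centre-degree ky) (deg≤ y)))
        (≤-trans (centre-degree (centre-sym ky)) (deg≤ v))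
        (here refl) (⊥-elim ∘ ¬xv) (here refl) (there (here refl)) (there (here refl)) (⊥-elim ∘ ¬xv)
        (λ xz yz → [ (λ xz → [ ⊥-elim ∘ block-far kx ky xz , (λ e → inj₂ (here e)) ]′ (A⁺-y yz)) , (λ e → inj₁ (here e)) ]′ (A⁺-x xz))
        (λ xz vz → [ (λ xz → ⊥-elim (block-far kx (centre-sym ky) xz (Av vz))) , (λ e → inj₁ (here e)) ]′ (A⁺-x xz))
        (λ yz vz → [ (λ yz → ⊥-elim (centres-disjoint ky (centre-sym ky) (adjacent⇒≢ yv) yz (Av vz))) , (λ e → inj₁ (here e)) ]′ (A⁺-y yz))
      where
      yv : A y v ≡ true
      yv = centre-adjacent ky
      x≢v : x ≢ v
      x≢v = kind-≢ kx (centre-sym ky) (λ ())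
      ¬xv : ¬ A⁺ x v ≡ true
      ¬xv h = [ block-centre kx (centre-sym ky) , adjacent⇒≢ yv ∘ ≡-sym ]′ (A⁺-x h)
      Av : ∀ {z} → A⁺ v z ≡ true → A v z ≡ true
      Av = A⁺-other (x≢v ∘ ≡-sym) (adjacent⇒≢ yv ∘ ≡-sym)

    leaf-any-cat : ∀ {c} → kind x ≡ leaf c → ContainsCat k A⁺
    leaf-any-cat {c} kx with leaf-centre kx
    ... | v , kc with v ≟ y
    ...   | yes refl = leaf-partner-cat kx kc
    ...   | no v≢y   = leaf-cat kx (λ kc′ → v≢y (centre-injective (trans (≡-sym kc) kc′)))
      where
      centre-injective : ∀ {a b} → centre a ≡ centre b → a ≡ b
      centre-injective refl = refl

  swap-ends : ∀ {x y} → ContainsCat k (addEdge A y x) → ContainsCat k (addEdge A x y)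
  swap-ends {x} {y} (f , f-injective , f-edges) = f , f-injective , λ u v e → flip (f-edges u v e)
    where
    flip : ∀ {u v} → addEdge A y x u v ≡ true → addEdge A x y u v ≡ true
    flip h with AddEdge.A⁺-cases A (sym G) y x h
    ... | inj₁ a                    = AddEdge.A⇒A⁺ A (sym G) x y a
    ... | inj₂ (inj₁ (refl , refl)) = AddEdge.A⁺-yx A (sym G) x y
    ... | inj₂ (inj₂ (refl , refl)) = AddEdge.A⁺-xy A (sym G) x y

  saturated : CatSaturated k G
  saturated = cat-free , added
    where
    added : ∀ x y → x ≢ y → A x y ≡ false → ContainsCat k (addEdge A x y)
    added x y x≢y xy with kind x in kx | kind y in ky
    ... | leaf _   | _        = leaf-any-cat x≢y xy kx
    ... | _        | leaf _   = swap-ends (leaf-any-cat (x≢y ∘ ≡-sym) (trans (sym G y x) xy) ky)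
    ... | centre _ | centre _ = centre-cat x≢y xy kx ky
    ... | block    | centre _ = block-cat x≢y xy kx ky
    ... | centre _ | block    = swap-ends (block-cat (x≢y ∘ ≡-sym) (trans (sym G y x) xy) ky kx)
    ... | block    | block    = ⊥-elim (true≢false (block-clique kx ky x≢y) xy)

-- Graphs on finite types given by neighbour lists

record Finite (V : Set) (n : ℕ) : Set where
  field
    enc     : V → Fin n
    dec     : Fin n → V
    dec-enc : ∀ v → dec (enc v) ≡ v
    enc-dec : ∀ i → enc (dec i) ≡ i

open Finite

total : Finite V n → (V → ℕ) → ℕ
total F f = sum (λ i → f (dec F i))

sum-↑ : ∀ m {n} (f : Fin (m + n) → ℕ) → sum f ≡ sum (λ i → f (i ↑ˡ n)) + sum (λ j → f (m ↑ʳ j))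
sum-↑ zero    f = refl
sum-↑ (suc m) f = trans (cong (f zero +_) (sum-↑ m (f ∘ suc))) (≡-sym (+-assoc (f zero) _ _))

finite-Fin : Finite (Fin n) n
finite-Fin = record { enc = id ; dec = id ; dec-enc = λ _ → refl ; enc-dec = λ _ → refl }

module _ (f : U → V) (g : V → U) (fg : ∀ v → f (g v) ≡ v) (gf : ∀ u → g (f u) ≡ u) where

  finite-iso : Finite U n → Finite V n
  finite-iso F = record
    { enc     = enc F ∘ g
    ; dec     = f ∘ dec F
    ; dec-enc = λ v → trans (cong f (dec-enc F (g v))) (fg v)
    ; enc-dec = λ i → trans (cong (enc F) (gf (dec F i))) (enc-dec F i)
    }

finite-⊎ : Finite U m → Finite V n → Finite (U ⊎ V) (m + n)
finite-⊎ {m = m} {n = n} F H = record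
  { enc     = join m n ∘ Data.Sum.map (enc F) (enc H)
  ; dec     = Data.Sum.map (dec F) (dec H) ∘ splitAt m
  ; dec-enc = λ v → trans (cong (Data.Sum.map (dec F) (dec H)) (Fin.splitAt-join m n (Data.Sum.map (enc F) (enc H) v))) (undo v)
  ; enc-dec = λ i → trans (cong (join m n) (redo (splitAt m i))) (Fin.join-splitAt m n i)
  }
  where
  undo : ∀ v → Data.Sum.map (dec F) (dec H) (Data.Sum.map (enc F) (enc H) v) ≡ v
  undo (inj₁ u) = cong inj₁ (dec-enc F u)
  undo (inj₂ v) = cong inj₂ (dec-enc H v)
  redo : ∀ x → Data.Sum.map (enc F) (enc H) (Data.Sum.map (dec F) (dec H) x) ≡ x
  redo (inj₁ i) = cong inj₁ (enc-dec F i)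
  redo (inj₂ j) = cong inj₂ (enc-dec H j)

total-⊎ : (F : Finite U m) (H : Finite V n) (f : U ⊎ V → ℕ) → total (finite-⊎ F H) f ≡ total F (f ∘ inj₁) + total H (f ∘ inj₂)
total-⊎ {m = m} {n = n} F H f = trans (sum-↑ m (λ i → f (dec (finite-⊎ F H) i))) (cong₂ _+_
  (sum-cong-≗ {m} (λ i → cong (f ∘ Data.Sum.map (dec F) (dec H)) (Fin.splitAt-↑ˡ m i n)))
  (sum-cong-≗ {n} (λ j → cong (f ∘ Data.Sum.map (dec F) (dec H)) (Fin.splitAt-↑ʳ m n j))))

module _ {W : Fin (suc m) → Set} where

  private
    Σ-cons : W zero ⊎ Σ (Fin m) (W ∘ suc) → Σ (Fin (suc m)) W
    Σ-cons (inj₁ w)       = zero , w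
    Σ-cons (inj₂ (i , w)) = suc i , w

    Σ-uncons : Σ (Fin (suc m)) W → W zero ⊎ Σ (Fin m) (W ∘ suc)
    Σ-uncons (zero , w)  = inj₁ w
    Σ-uncons (suc i , w) = inj₂ (i , w)

  finite-cons : ∀ {a b} → Finite (W zero) a → Finite (Σ (Fin m) (W ∘ suc)) b → Finite (Σ (Fin (suc m)) W) (a + b)
  finite-cons F H = finite-iso Σ-cons Σ-uncons (λ { (zero , _) → refl ; (suc _ , _) → refl }) (λ { (inj₁ _) → refl ; (inj₂ _) → refl }) (finite-⊎ F H)

  total-cons : ∀ {a b} (F : Finite (W zero) a) (H : Finite (Σ (Fin m) (W ∘ suc)) b) (f : Σ (Fin (suc m)) W → ℕ) →
    total (finite-cons F H) f ≡ total F (λ w → f (zero , w)) + total H (λ { (i , w) → f (suc i , w) })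
  total-cons F H f = trans (total-⊎ F H (f ∘ Σ-cons)) refl

finite-Σ : ∀ {W : Fin m → Set} {g : Fin m → ℕ} → (∀ i → Finite (W i) (g i)) → Finite (Σ (Fin m) W) (sum g)
finite-Σ {zero}  F = record { enc = λ () ; dec = λ () ; dec-enc = λ () ; enc-dec = λ () }
finite-Σ {suc m} F = finite-cons (F zero) (finite-Σ (F ∘ suc))

total-Σ : ∀ {W : Fin m → Set} {g : Fin m → ℕ} (F : ∀ i → Finite (W i) (g i)) (f : Σ (Fin m) W → ℕ) →
  total (finite-Σ F) f ≡ sum (λ i → total (F i) (λ w → f (i , w)))
total-Σ {zero}  F f = refl
total-Σ {suc m} F f = trans (total-cons (F zero) (finite-Σ (F ∘ suc)) f)
  (cong (total (F zero) (λ w → f (zero , w)) +_) (total-Σ (F ∘ suc) (λ { (i , w) → f (suc i , w) })))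

-- Numbering the neighbours without repetition makes the degrees part of the data; no vertices have
-- to be counted for an individual graph.
record Neighbours (V : Set) : Set where
  field
    degree        : V → ℕ
    nbr           : ∀ v → Fin (degree v) → V
    nbr-injective : ∀ v → Injective _≡_ _≡_ (nbr v)
    nbr-sym       : ∀ v i → ∃ λ j → nbr (nbr v i) j ≡ v
    nbr-irr       : ∀ v i → nbr v i ≢ v

  Adj : V → V → Set
  Adj u v = ∃ λ i → nbr u i ≡ v

module FromNeighbours (F : Finite V n) (N : Neighbours V) where

  open Neighbours N

  private
    adjacent? : ∀ i j → Dec (∃ λ t → enc F (nbr (dec F i) t) ≡ j)
    adjacent? i j = Fin.any? (λ t → enc F (nbr (dec F i) t) ≟ j)

    flip : ∀ {i j} → (∃ λ t → enc F (nbr (dec F i) t) ≡ j) → ∃ λ t → enc F (nbr (dec F j) t) ≡ i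
    flip {i} (t , refl) rewrite dec-enc F (nbr (dec F i) t) with nbr-sym (dec F i) t
    ... | t′ , e = t′ , trans (cong (enc F) e) (enc-dec F i)

  graph : SimpleGraph n
  graph = record
    { adj    = λ i j → does (adjacent? i j)
    ; sym    = λ i j → true-ext (dec-true (adjacent? j i) ∘ flip ∘ does-true (adjacent? i j)) (dec-true (adjacent? i j) ∘ flip ∘ does-true (adjacent? j i))
    ; irrefl = λ i → dec-false (adjacent? i i) λ { (t , e) → nbr-irr (dec F i) t (trans (≡-sym (dec-enc F _)) (cong (dec F) e)) }
    }

  adj⇒Adj : ∀ {i j} → adj graph i j ≡ true → Adj (dec F i) (dec F j)
  adj⇒Adj {i} {j} h with does-true (adjacent? i j) h
  ... | t , e = t , trans (≡-sym (dec-enc F _)) (cong (dec F) e)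

  Adj⇒adj : ∀ {i j} → Adj (dec F i) (dec F j) → adj graph i j ≡ true
  Adj⇒adj {i} {j} (t , e) = dec-true (adjacent? i j) (t , trans (cong (enc F) e) (enc-dec F j))

  deg-degree : ∀ i → deg graph i ≡ degree (dec F i)
  deg-degree i = ≤-antisym
    (surjection⇒count≤ {P = adj graph i} (enc F ∘ nbr (dec F i)) (λ j → does-true (adjacent? i j)))
    (injection⇒≤count {P = adj graph i} (enc F ∘ nbr (dec F i))
      (λ e → nbr-injective (dec F i) (trans (≡-sym (dec-enc F _)) (trans (cong (dec F) e) (dec-enc F _))))
      (λ t → dec-true (adjacent? i _) (t , refl)))

  degree-sum : 2 * edgeCount graph ≡ total F degree
  degree-sum = trans (≡-sym (handshake graph)) (sum-cong-≗ {n} deg-degree)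

  doubleStars : DoubleStars k Adj degree → DoubleStars k (λ i j → adj graph i j ≡ true) (deg graph)
  doubleStars {k} stars = record
    { kind            = kind′
    ; centre-adjacent = λ ku → Adj⇒adj (centre-adjacent (centre⁻ ku))
    ; centre-sym      = λ {u} {v} ku → trans (cong (map-kind) (centre-sym (centre⁻ ku))) (cong centre (enc-dec F u))
    ; centre-degree   = λ {u} ku → subst (3 + k ≤_) (≡-sym (deg-degree u)) (centre-degree (centre⁻ ku))
    ; centre-only     = λ ku kw uw → dec-injective (centre-only (centre⁻ ku) (centre⁻ kw) (adj⇒Adj uw))
    ; leaf-adjacent   = λ kx → Adj⇒adj (leaf-adjacent (leaf⁻ kx))
    ; leaf-centre     = λ kx → let (v , kc) = leaf-centre (leaf⁻ kx) in enc F v , cong map-kind kc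
    ; leaf-degree     = λ {x} kx → trans (deg-degree x) (leaf-degree (leaf⁻ kx))
    ; leaf-only       = λ kx kw xw → dec-injective (leaf-only (leaf⁻ kx) (centre⁻ kw) (adj⇒Adj xw))
    ; leaf-common     = λ {x} {c} kx → let (E , E≤ , common) = leaf-common (leaf⁻ kx) in
                          map (enc F) E ,
                          subst₂ (λ l d → 3 + k + l ≤ d) (≡-sym (length-map (enc F) E)) (≡-sym (deg-degree c)) E≤ ,
                          λ {z} xz cz → subst (_∈ map (enc F) E) (enc-dec F z) (∈-map⁺ (enc F) (common (adj⇒Adj xz) (adj⇒Adj cz)))
    ; leaf-far        = λ kx kc xz vz → dec-injective (leaf-far (leaf⁻ kx) (centre⁻ kc) (adj⇒Adj xz) (adj⇒Adj vz))
    ; block-degree    = λ {x} kx → trans (deg-degree x) (block-degree (block⁻ kx))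
    ; block-clique    = λ kx ky x≢y → Adj⇒adj (block-clique (block⁻ kx) (block⁻ ky) (x≢y ∘ dec-injective))
    ; block-centre    = λ kx ku xu → block-centre (block⁻ kx) (centre⁻ ku) (adj⇒Adj xu)
    ; block-far       = λ kx ku xz uz → block-far (block⁻ kx) (centre⁻ ku) (adj⇒Adj xz) (adj⇒Adj uz)
    }
    where
    open DoubleStars stars
    map-kind : Kind V → Kind (Fin n)
    map-kind (centre v) = centre (enc F v)
    map-kind (leaf v)   = leaf (enc F v)
    map-kind block      = block
    kind′ : Fin n → Kind (Fin n)
    kind′ i = map-kind (kind (dec F i))
    dec-injective : ∀ {i j} → dec F i ≡ dec F j → i ≡ j
    dec-injective {i} {j} e = trans (≡-sym (enc-dec F i)) (trans (cong (enc F) e) (enc-dec F j))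
    centre⁻ : ∀ {u v} → kind′ u ≡ centre v → kind (dec F u) ≡ centre (dec F v)
    centre⁻ {u} h with kind (dec F u)
    centre⁻ refl | centre v = cong centre (≡-sym (dec-enc F v))
    leaf⁻ : ∀ {u v} → kind′ u ≡ leaf v → kind (dec F u) ≡ leaf (dec F v)
    leaf⁻ {u} h with kind (dec F u)
    leaf⁻ refl | leaf v = cong leaf (≡-sym (dec-enc F v))
    block⁻ : ∀ {u} → kind′ u ≡ block → kind (dec F u) ≡ block
    block⁻ {u} h with kind (dec F u)
    block⁻ refl | block = refl

-- Regular graphs on the leaves

-- The solution l of j + l ≡ i modulo M.
module Complement {M : ℕ} where

  Sums : Fin M → Fin M → Fin M → Set
  Sums i j l = toℕ j + toℕ l ≡ toℕ i ⊎ toℕ j + toℕ l ≡ M + toℕ i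

  abstract
    sums : ∀ i j → ∃ (Sums i j)
    sums i j with toℕ j ≤? toℕ i
    ... | yes j≤i = Data.Fin.fromℕ< l<M , inj₁ (trans (cong (toℕ j +_) (Fin.toℕ-fromℕ< l<M)) (m+[n∸m]≡n j≤i))
      where
      l<M : toℕ i ∸ toℕ j < M
      l<M = ≤-trans (s≤s (m∸n≤m (toℕ i) (toℕ j))) (Fin.toℕ<n i)
    ... | no j≰i = Data.Fin.fromℕ< l<M , inj₂ (trans (cong (toℕ j +_) (Fin.toℕ-fromℕ< l<M)) (m+[n∸m]≡n j≤M+i))
      where
      j≤M+i : toℕ j ≤ M + toℕ i
      j≤M+i = ≤-trans (<⇒≤ (Fin.toℕ<n j)) (m≤m+n M (toℕ i))
      l<M : M + toℕ i ∸ toℕ j < M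
      l<M = +-cancelˡ-< (toℕ j) _ _ (subst₂ _<_ (≡-sym (m+[n∸m]≡n j≤M+i)) (+-comm M (toℕ j)) (+-monoʳ-< M (≰⇒> j≰i)))

  -- This is `i` - `j` modulo `M`. For fixed `i` it is an involution, so the pairs of `j` and
  -- `compl i j` form a perfect matching between two copies of `Fin M`; different `i` give disjoint
  -- matchings. They serve as colour classes of the complete bipartite graph.
  compl : Fin M → Fin M → Fin M
  compl i j = proj₁ (sums i j)

  private
    no-wrap : ∀ (i : Fin M) {a} → M + a ≢ toℕ i
    no-wrap i {a} e = <-irrefl refl (≤-trans (s≤s (m+n≤o⇒m≤o M (≤-reflexive e))) (Fin.toℕ<n i))

  sums-unique : ∀ {i j l l′} → Sums i j l → Sums i j l′ → l ≡ l′
  sums-unique {i} {j} {l} {l′} (inj₁ p) (inj₁ q) = Fin.toℕ-injective (+-cancelˡ-≡ (toℕ j) _ _ (trans p (≡-sym q)))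
  sums-unique {i} {j} {l} {l′} (inj₂ p) (inj₂ q) = Fin.toℕ-injective (+-cancelˡ-≡ (toℕ j) _ _ (trans p (≡-sym q)))
  sums-unique {i} {j} {l} {l′} (inj₁ p) (inj₂ q) = ⊥-elim (no-wrap l′ (+-cancelˡ-≡ (toℕ j) _ _
    (trans (trans (≡-sym (+-assoc (toℕ j) M _)) (trans (cong (_+ toℕ l) (+-comm (toℕ j) M)) (trans (+-assoc M _ _) (cong (M +_) p)))) (≡-sym q))))
  sums-unique {i} {j} {l} {l′} (inj₂ p) (inj₁ q) = ≡-sym (sums-unique {i} {j} {l′} {l} (inj₁ q) (inj₂ p))

  compl-involutive : ∀ i j → compl i (compl i j) ≡ j
  compl-involutive i j = sums-unique {i} {compl i j} (proj₂ (sums i (compl i j)))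
    (Data.Sum.map (trans (+-comm _ (toℕ j))) (trans (+-comm _ (toℕ j))) (proj₂ (sums i j)))

  compl-injectiveˡ : ∀ {i i′} j → compl i j ≡ compl i′ j → i ≡ i′
  compl-injectiveˡ {i} {i′} j e with compl i j | proj₂ (sums i j) | compl i′ j | proj₂ (sums i′ j)
  compl-injectiveˡ {i} {i′} j refl | l | inj₁ p | .l | inj₁ q = Fin.toℕ-injective (trans (≡-sym p) q)
  compl-injectiveˡ {i} {i′} j refl | l | inj₂ p | .l | inj₂ q = Fin.toℕ-injective (+-cancelˡ-≡ M _ _ (trans (≡-sym p) q))
  compl-injectiveˡ {i} {i′} j refl | l | inj₁ p | .l | inj₂ q = ⊥-elim (no-wrap i (trans (≡-sym q) p))
  compl-injectiveˡ {i} {i′} j refl | l | inj₂ p | .l | inj₁ q = ⊥-elim (no-wrap i′ (trans (≡-sym p) q))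

-- A k-regular graph on two leaf sets of sizes a and b; a leaf may have a few neighbours
-- in its own set, provided that set is accordingly larger.
record Piece (k a b : ℕ) : Set where
  field
    nbr           : Fin a ⊎ Fin b → Fin k → Fin a ⊎ Fin b
    nbr-injective : ∀ v → Injective _≡_ _≡_ (nbr v)
    nbr-sym       : ∀ v i → ∃ λ j → nbr (nbr v i) j ≡ v
    nbr-irr       : ∀ v i → nbr v i ≢ v
    sizeˡ         : 2 + k ≤ a
    sizeʳ         : 2 + k ≤ b
    ownˡ          : ∀ x → Σ (List (Fin a)) λ E → 2 + k + length E ≤ a × (∀ i {z} → nbr (inj₁ x) i ≡ inj₁ z → z ∈ E)
    ownʳ          : ∀ y → Σ (List (Fin b)) λ E → 2 + k + length E ≤ b × (∀ i {z} → nbr (inj₂ y) i ≡ inj₂ z → z ∈ E)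

open Complement

-- The union of `k` colour classes of a complete bipartite graph. An edge has the same index at both
-- of its ends, and no leaf has a neighbour on its own side.
even-piece : ∀ k e → Piece k (k + (2 + e)) (k + (2 + e))
even-piece k e = record
  { nbr           = nb
  ; nbr-injective = inj
  ; nbr-sym       = λ v i → i , nb-involutive v i
  ; nbr-irr       = λ { (inj₁ _) i () ; (inj₂ _) i () }
  ; sizeˡ         = size
  ; sizeʳ         = size
  ; ownˡ          = λ x → [] , ≤-trans (≤-reflexive (+-identityʳ (2 + k))) size , λ i ()
  ; ownʳ          = λ y → [] , ≤-trans (≤-reflexive (+-identityʳ (2 + k))) size , λ i ()
  }
  where
  M : ℕ
  M = k + (2 + e)
  nb : Fin M ⊎ Fin M → Fin k → Fin M ⊎ Fin M
  nb (inj₁ j) i = inj₂ (compl (i ↑ˡ (2 + e)) j)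
  nb (inj₂ l) i = inj₁ (compl (i ↑ˡ (2 + e)) l)
  nb-involutive : ∀ v i → nb (nb v i) i ≡ v
  nb-involutive (inj₁ j) i = cong inj₁ (compl-involutive _ j)
  nb-involutive (inj₂ l) i = cong inj₂ (compl-involutive _ l)
  inj : ∀ v → Injective _≡_ _≡_ (nb v)
  inj (inj₁ j) {i} {i′} h = Fin.↑ˡ-injective (2 + e) i i′ (compl-injectiveˡ j (Sum.inj₂-injective h))
  inj (inj₂ l) {i} {i′} h = Fin.↑ˡ-injective (2 + e) i i′ (compl-injectiveˡ l (Sum.inj₁-injective h))
  size : 2 + k ≤ M
  size = ≤-trans (≤-reflexive (+-comm 2 k)) (+-monoʳ-≤ k (s≤s (s≤s z≤n)))

-- One more leaf w on the left, for even degree: the first k edges {x j , y} of colour 0 are replaced by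
-- {w , y} and by a perfect matching of the left ends x j (j < k).
odd-piece : ∀ k e → (∀ (j : Fin k) → opposite j ≢ j) → Piece k (suc (k + (2 + e))) (k + (2 + e))
-- Without colours there are no edges; the general case needs a colour 0.
odd-piece zero e _ = record
  { nbr           = λ _ ()
  ; nbr-injective = λ { _ {()} }
  ; nbr-sym       = λ _ ()
  ; nbr-irr       = λ _ ()
  ; sizeˡ         = s≤s (s≤s z≤n)
  ; sizeʳ         = s≤s (s≤s z≤n)
  ; ownˡ          = λ _ → [] , s≤s (s≤s z≤n) , λ ()
  ; ownʳ          = λ _ → [] , s≤s (s≤s z≤n) , λ ()
  }
odd-piece (suc k′) e opposite≢ = record
  { nbr           = nb
  ; nbr-injective = inj
  ; nbr-sym       = nb-sym
  ; nbr-irr       = irr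
  ; sizeˡ         = ≤-trans size (m≤n+m M 1)
  ; sizeʳ         = size
  ; ownˡ          = own
  ; ownʳ          = λ y → [] , ≤-trans (≤-reflexive (+-identityʳ (2 + K))) size , λ { zero h → ⊥-elim (y₀-left (splitAt K (compl colour₀ y)) h) ; (suc i) () }
  }
  where
  K M : ℕ
  K = suc k′
  M = K + (2 + e)
  colour : Fin K → Fin M
  colour i = i ↑ˡ (2 + e)
  colour₀ : Fin M
  colour₀ = colour zero
  size : 2 + K ≤ M
  size = ≤-trans (≤-reflexive (+-comm 2 K)) (+-monoʳ-≤ K (s≤s (s≤s z≤n)))

  -- The neighbour in slot 0 of an old left vertex, and in `y₀` of a right vertex. The first case of
  -- the split marks the edges of colour 0 that are replaced, recognised by their left end.
  x₀ : Fin K ⊎ Fin (2 + e) → Fin M → Fin (suc M) ⊎ Fin M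
  x₀ (inj₁ j) _ = inj₁ (suc (colour (opposite j)))
  x₀ (inj₂ _) j = inj₂ (compl colour₀ j)
  y₀ : Fin K ⊎ Fin (2 + e) → Fin M → Fin (suc M) ⊎ Fin M
  y₀ (inj₁ _) _ = inj₁ zero
  y₀ (inj₂ _) l = inj₁ (suc (compl colour₀ l))

  nb : Fin (suc M) ⊎ Fin M → Fin K → Fin (suc M) ⊎ Fin M
  nb (inj₁ zero)    i       = inj₂ (compl colour₀ (colour i))
  nb (inj₁ (suc j)) zero    = x₀ (splitAt K j) j
  nb (inj₁ (suc j)) (suc i) = inj₂ (compl (colour (suc i)) j)
  nb (inj₂ l)       zero    = y₀ (splitAt K (compl colour₀ l)) l
  nb (inj₂ l)       (suc i) = inj₁ (suc (compl (colour (suc i)) l))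

  y₀-left : ∀ s {l z} → y₀ s l ≢ inj₂ z
  y₀-left (inj₁ _) ()
  y₀-left (inj₂ _) ()

  colour-differ : ∀ {i j} → compl colour₀ j ≢ compl (colour (suc i)) j
  colour-differ {i} {j} h = Fin.0≢1+n (Fin.↑ˡ-injective (2 + e) zero (suc i) (compl-injectiveˡ j h))

  x₀-differ : ∀ s {i j} → x₀ s j ≢ inj₂ (compl (colour (suc i)) j)
  x₀-differ (inj₁ _) ()
  x₀-differ (inj₂ _) h = colour-differ (Sum.inj₂-injective h)

  y₀-differ : ∀ s {i l} → y₀ s l ≢ inj₁ (suc (compl (colour (suc i)) l))
  y₀-differ (inj₁ _) ()
  y₀-differ (inj₂ _) h = colour-differ (Fin.suc-injective (Sum.inj₁-injective h))

  inj : ∀ v → Injective _≡_ _≡_ (nb v)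
  inj (inj₁ zero) {i} {i′} h = Fin.↑ˡ-injective (2 + e) i i′
    (trans (≡-sym (compl-involutive colour₀ _)) (trans (cong (compl colour₀) (Sum.inj₂-injective h)) (compl-involutive colour₀ _)))
  inj (inj₁ (suc j)) {zero}  {zero}   h = refl
  inj (inj₁ (suc j)) {zero}  {suc i′} h = ⊥-elim (x₀-differ (splitAt K j) h)
  inj (inj₁ (suc j)) {suc i} {zero}   h = ⊥-elim (x₀-differ (splitAt K j) (≡-sym h))
  inj (inj₁ (suc j)) {suc i} {suc i′} h = Fin.↑ˡ-injective (2 + e) _ _ (compl-injectiveˡ j (Sum.inj₂-injective h))
  inj (inj₂ l)       {zero}  {zero}   h = refl
  inj (inj₂ l)       {zero}  {suc i′} h = ⊥-elim (y₀-differ (splitAt K (compl colour₀ l)) h)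
  inj (inj₂ l)       {suc i} {zero}   h = ⊥-elim (y₀-differ (splitAt K (compl colour₀ l)) (≡-sym h))
  inj (inj₂ l)       {suc i} {suc i′} h = Fin.↑ˡ-injective (2 + e) _ _ (compl-injectiveˡ l (Fin.suc-injective (Sum.inj₁-injective h)))

  nb-sym : ∀ v i → ∃ λ j → nb (nb v i) j ≡ v
  nb-sym (inj₁ zero) i = zero , trans
    (cong (λ t → y₀ (splitAt K t) (compl colour₀ (colour i))) (compl-involutive colour₀ (colour i)))
    (cong (λ t → y₀ t (compl colour₀ (colour i))) (Fin.splitAt-↑ˡ K i (2 + e)))
  nb-sym (inj₁ (suc j)) zero with splitAt K j in eq
  ... | inj₁ j′ = zero , trans
          (cong (λ t → x₀ t (colour (opposite j′))) (Fin.splitAt-↑ˡ K (opposite j′) (2 + e)))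
          (cong (inj₁ ∘ suc) (trans (cong colour (Fin.opposite-involutive j′)) (Fin.splitAt⁻¹-↑ˡ eq)))
  ... | inj₂ _  = zero , trans
          (cong (λ t → y₀ (splitAt K t) (compl colour₀ j)) (compl-involutive colour₀ j))
          (trans (cong (λ t → y₀ t (compl colour₀ j)) eq) (cong (inj₁ ∘ suc) (compl-involutive colour₀ j)))
  nb-sym (inj₁ (suc j)) (suc i) = suc i , cong (inj₁ ∘ suc) (compl-involutive _ j)
  nb-sym (inj₂ l) zero with splitAt K (compl colour₀ l) in eq
  ... | inj₁ j = j , cong inj₂ (trans (cong (compl colour₀) (Fin.splitAt⁻¹-↑ˡ eq)) (compl-involutive colour₀ l))
  ... | inj₂ _ = zero , trans (cong (λ t → x₀ t (compl colour₀ l)) eq) (cong inj₂ (compl-involutive colour₀ l))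
  nb-sym (inj₂ l) (suc i) = suc i , cong inj₂ (compl-involutive _ l)

  irr : ∀ v i → nb v i ≢ v
  irr (inj₁ zero)    i       ()
  irr (inj₁ (suc j)) (suc i) ()
  irr (inj₂ l)       (suc i) ()
  irr (inj₂ l)       zero    h = y₀-left (splitAt K (compl colour₀ l)) h
  irr (inj₁ (suc j)) zero    h with splitAt K j in eq
  ... | inj₁ j′ = opposite≢ j′ (Fin.↑ˡ-injective (2 + e) _ _
          (trans (Fin.suc-injective (Sum.inj₁-injective h)) (≡-sym (Fin.splitAt⁻¹-↑ˡ eq))))

  own : ∀ x → Σ (List (Fin (suc M))) λ E → 2 + K + length E ≤ suc M × (∀ i {z} → nb (inj₁ x) i ≡ inj₁ z → z ∈ E)
  own zero = [] , ≤-trans (≤-reflexive (+-identityʳ (2 + K))) (≤-trans size (m≤n+m M 1)) , λ i ()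
  own (suc j) with splitAt K j in eq
  -- The vertex matched with this one is its only neighbour on its own side; the added leaf enlarges
  -- that side by the one place that this costs.
  ... | inj₁ j′ = suc (colour (opposite j′)) ∷ [] , ≤-trans (≤-reflexive (+-comm (2 + K) 1)) (s≤s size) ,
                  λ { zero h → here (Sum.inj₁-injective (trans (≡-sym h) (cong (λ t → x₀ t j) eq))) ; (suc i) () }
  ... | inj₂ _  = [] , ≤-trans (≤-reflexive (+-identityʳ (2 + K))) (≤-trans size (m≤n+m M 1)) ,
                  λ { zero h → ⊥-elim (x₀-right (trans (≡-sym (cong (λ t → x₀ t j) eq)) h)) ; (suc i) () }
    where
    x₀-right : ∀ {z} → inj₂ (compl colour₀ j) ≢ inj₁ z
    x₀-right ()

-- Linking the pieces in a cycle

prev : Fin (suc n) → Fin (suc n)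
prev zero    = fromℕ _
prev (suc i) = inject₁ i

next : Fin (suc n) → Fin (suc n)
next i with view i
... | ‵fromℕ     = zero
... | ‵inject₁ j = suc j

next-prev : (i : Fin (suc n)) → next (prev i) ≡ i
next-prev {n} zero rewrite view-fromℕ n = refl
next-prev (suc i) rewrite view-inject₁ i = refl

prev-next : (i : Fin (suc n)) → prev (next i) ≡ i
prev-next i with view i
... | ‵fromℕ     = refl
... | ‵inject₁ j = refl

-- A cyclic shift moves every element once there are two; hence the number of pieces below has the
-- form `2 + l`.
prev≢ : (i : Fin (2 + n)) → prev i ≢ i
prev≢ (suc i) e = 1+n≢n (≡-sym (trans (≡-sym (Fin.toℕ-inject₁ i)) (cong toℕ e)))

next≢ : (i : Fin (2 + n)) → next i ≢ i
next≢ i e = prev≢ i (trans (cong prev (≡-sym e)) (prev-next i))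

-- The hubs (i , false) and (i , true) carry the two leaf sets of the i-th piece as pendant vertices;
-- each hub is adjacent to a hub of another piece, so that a leaf has no neighbours
-- among the leaves of its hub's partner.
module Construction (k l c : ℕ) (c≤1 : c ≤ 1) {a b : Fin (2 + l) → ℕ} (piece : ∀ i → Piece k (a i) (b i)) where

  -- `Fin c` with `c` at most 1 encodes the optional clique, so order and degree sum are linear in
  -- `c` and need no case distinction.
  data Vertex : Set where
    hub : Fin (2 + l) → Bool → Vertex
    tip : (i : Fin (2 + l)) → Fin (a i) ⊎ Fin (b i) → Vertex
    blk : Fin c → Fin (2 + k) → Vertex

  tip-injective : ∀ {i v w} → tip i v ≡ tip i w → v ≡ w
  tip-injective refl = refl

  tip-index : ∀ {i j v w} → tip i v ≡ tip j w → i ≡ j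
  tip-index refl = refl

  hub-index : ∀ {i j σ τ} → hub i σ ≡ hub j τ → i ≡ j
  hub-index refl = refl

  blk-injective : ∀ {q p i j} → blk q i ≡ blk p j → i ≡ j
  blk-injective refl = refl

  leafCount : Fin (2 + l) → Bool → ℕ
  leafCount i false = a i
  leafCount i true  = b i

  ray : ∀ i σ → Fin (leafCount i σ) → Fin (a i) ⊎ Fin (b i)
  ray i false = inj₁
  ray i true  = inj₂

  ray-injective : ∀ i σ {x y} → ray i σ x ≡ ray i σ y → x ≡ y
  ray-injective i false = Sum.inj₁-injective
  ray-injective i true  = Sum.inj₂-injective

  side : ∀ {i} → Fin (a i) ⊎ Fin (b i) → Bool
  side (inj₁ _) = false
  side (inj₂ _) = true

  partner : Fin (2 + l) → Bool → Vertex
  partner i false = hub (next i) true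
  partner i true  = hub (prev i) false

  neighbours : Neighbours Vertex
  neighbours = record
    { degree        = degree
    ; nbr           = nbr
    ; nbr-injective = nbr-injective
    ; nbr-sym       = nbr-sym
    ; nbr-irr       = nbr-irr
    }
    where
    degree : Vertex → ℕ
    degree (hub i σ) = suc (leafCount i σ)
    degree (tip i v) = suc k
    degree (blk q j) = suc k
    nbr : ∀ v → Fin (degree v) → Vertex
    nbr (hub i σ) zero    = partner i σ
    nbr (hub i σ) (suc x) = tip i (ray i σ x)
    nbr (tip i v) zero    = hub i (side v)
    nbr (tip i v) (suc j) = tip i (Piece.nbr (piece i) v j)
    nbr (blk q j) t       = blk q (punchIn j t)
    partner≢tip : ∀ i σ {j v} → partner i σ ≢ tip j v
    partner≢tip i false ()
    partner≢tip i true  ()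
    nbr-injective : ∀ v → Injective _≡_ _≡_ (nbr v)
    nbr-injective (hub i σ) {zero}  {zero}  e = refl
    nbr-injective (hub i σ) {zero}  {suc y} e = ⊥-elim (partner≢tip i σ e)
    nbr-injective (hub i σ) {suc x} {zero}  e = ⊥-elim (partner≢tip i σ (≡-sym e))
    nbr-injective (hub i σ) {suc x} {suc y} e = cong suc (ray-injective i σ (tip-injective e))
    nbr-injective (tip i v) {zero}  {zero}  e = refl
    nbr-injective (tip i v) {suc x} {suc y} e = cong suc (Piece.nbr-injective (piece i) v (tip-injective e))
    nbr-injective (blk q j) {x}     {y}     e = Fin.punchIn-injective j x y (blk-injective e)
    nbr-sym : ∀ v i → ∃ λ j → nbr (nbr v i) j ≡ v
    nbr-sym (hub i false) zero    = zero , cong (λ t → hub t false) (prev-next i)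
    nbr-sym (hub i true)  zero    = zero , cong (λ t → hub t true) (next-prev i)
    nbr-sym (hub i false) (suc x) = zero , refl
    nbr-sym (hub i true)  (suc x) = zero , refl
    nbr-sym (tip i (inj₁ x)) zero = suc x , refl
    nbr-sym (tip i (inj₂ y)) zero = suc y , refl
    nbr-sym (tip i v) (suc j) with Piece.nbr-sym (piece i) v j
    ... | j′ , e = suc j′ , cong (tip i) e
    nbr-sym (blk q j) t = punchOut (Fin.punchInᵢ≢i j t) , cong (blk q) (Fin.punchIn-punchOut (Fin.punchInᵢ≢i j t))
    nbr-irr : ∀ v i → nbr v i ≢ v
    nbr-irr (hub i false) zero    e = next≢ i (hub-index e)
    nbr-irr (hub i true)  zero    e = prev≢ i (hub-index e)
    nbr-irr (tip i v)     (suc j) e = Piece.nbr-irr (piece i) v j (tip-injective e)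
    nbr-irr (blk q j)     t       e = Fin.punchInᵢ≢i j t (blk-injective e)

  open Neighbours neighbours

  stars : DoubleStars k Adj degree
  stars = record
    { kind            = kind
    ; centre-adjacent = centre-adjacent
    ; centre-sym      = centre-sym
    ; centre-degree   = centre-degree
    ; centre-only     = centre-only
    ; leaf-adjacent   = leaf-adjacent
    ; leaf-centre     = leaf-centre
    ; leaf-degree     = leaf-degree
    ; leaf-only       = leaf-only
    ; leaf-common     = leaf-common
    ; leaf-far        = leaf-far
    ; block-degree    = block-degree
    ; block-clique    = block-clique
    ; block-centre    = block-centre
    ; block-far       = block-far
    }
    where
    kind : Vertex → Kind Vertex
    kind (hub i σ) = centre (partner i σ)
    kind (tip i v) = leaf (hub i (side v))
    kind (blk q j) = block
    centre-adjacent : ∀ {u v} → kind u ≡ centre v → Adj u v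
    centre-adjacent {hub i σ} refl = zero , refl
    centre-sym : ∀ {u v} → kind u ≡ centre v → kind v ≡ centre u
    centre-sym {hub i false} refl = cong (λ t → centre (hub t false)) (prev-next i)
    centre-sym {hub i true}  refl = cong (λ t → centre (hub t true)) (next-prev i)
    own : ∀ i v → Σ (List Vertex) λ E → 3 + k + length E ≤ suc (leafCount i (side v)) ×
      (∀ {z} → Adj (tip i v) z → Adj (hub i (side v)) z → z ∈ E)
    own i (inj₁ x) with Piece.ownˡ (piece i) x
    ... | E , E≤ , cover = map (tip i ∘ inj₁) E , subst (λ t → 3 + k + t ≤ suc (a i)) (≡-sym (length-map _ E)) (s≤s E≤) , common
      where
      common : ∀ {z} → Adj (tip i (inj₁ x)) z → Adj (hub i false) z → z ∈ map (tip i ∘ inj₁) E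
      common (zero , refl)  (zero , e)  = ⊥-elim (next≢ i (hub-index e))
      common (suc j , refl) (suc y , e) = subst (_∈ map (tip i ∘ inj₁) E) e (∈-map⁺ (tip i ∘ inj₁) (cover j (≡-sym (tip-injective e))))
    own i (inj₂ x) with Piece.ownʳ (piece i) x
    ... | E , E≤ , cover = map (tip i ∘ inj₂) E , subst (λ t → 3 + k + t ≤ suc (b i)) (≡-sym (length-map _ E)) (s≤s E≤) , common
      where
      common : ∀ {z} → Adj (tip i (inj₂ x)) z → Adj (hub i true) z → z ∈ map (tip i ∘ inj₂) E
      common (zero , refl)  (zero , e)  = ⊥-elim (prev≢ i (hub-index e))
      common (suc j , refl) (suc y , e) = subst (_∈ map (tip i ∘ inj₂) E) e (∈-map⁺ (tip i ∘ inj₂) (cover j (≡-sym (tip-injective e))))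
    centre-degree : ∀ {u v} → kind u ≡ centre v → 3 + k ≤ degree u
    centre-degree {hub i false} refl = s≤s (Piece.sizeˡ (piece i))
    centre-degree {hub i true}  refl = s≤s (Piece.sizeʳ (piece i))
    centre-only : ∀ {u v w z} → kind u ≡ centre v → kind w ≡ centre z → Adj u w → w ≡ v
    centre-only {hub i σ} {w = hub j τ} refl refl (zero , e)  = ≡-sym e
    leaf-adjacent : ∀ {x c} → kind x ≡ leaf c → Adj x c
    leaf-adjacent {tip i v} refl = zero , refl
    leaf-centre : ∀ {x c} → kind x ≡ leaf c → ∃ λ v → kind c ≡ centre v
    leaf-centre {tip i v} refl = partner i (side v) , refl
    leaf-degree : ∀ {x c} → kind x ≡ leaf c → degree x ≡ suc k
    leaf-degree {tip i v} refl = refl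
    leaf-only : ∀ {x c w z} → kind x ≡ leaf c → kind w ≡ centre z → Adj x w → w ≡ c
    leaf-only {tip i v} {w = hub j τ} refl refl (zero , e) = ≡-sym e
    leaf-common : ∀ {x c} → kind x ≡ leaf c → Σ (List Vertex) λ E → 3 + k + length E ≤ degree c × (∀ {z} → Adj x z → Adj c z → z ∈ E)
    leaf-common {tip i v} refl = own i v
    -- A tip is adjacent to its hub and to tips of its own piece, whereas a hub of another piece is
    -- adjacent to one hub and to tips of that other piece. Only the hub of the tip can be common.
    far : ∀ {i j v σ z} → j ≢ i → Adj (tip i v) z → Adj (hub j σ) z → z ≡ hub i (side v)
    far         j≢i (zero , refl)  _           = refl
    far {σ = σ} j≢i (suc x , refl) (suc y , e) = ⊥-elim (j≢i (tip-index e))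
    far {σ = false} j≢i (suc x , refl) (zero , ())
    far {σ = true}  j≢i (suc x , refl) (zero , ())
    leaf-far : ∀ {x c v z} → kind x ≡ leaf c → kind c ≡ centre v → Adj x z → Adj v z → z ≡ c
    leaf-far {tip i (inj₁ _)} refl refl = far (next≢ i)
    leaf-far {tip i (inj₂ _)} refl refl = far (prev≢ i)
    block-degree : ∀ {x} → kind x ≡ block → degree x ≡ suc k
    block-degree {blk q j} refl = refl
    unique : ∀ {c} → c ≤ 1 → (p q : Fin c) → p ≡ q
    unique (s≤s z≤n) zero zero = refl
    block-clique : ∀ {x y} → kind x ≡ block → kind y ≡ block → x ≢ y → Adj x y
    block-clique {blk q i} {blk p j} refl refl x≢y rewrite unique c≤1 p q =
      punchOut i≢j , cong (blk q) (Fin.punchIn-punchOut i≢j)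
      where
      i≢j : i ≢ j
      i≢j e = x≢y (cong (blk q) e)
    block-centre : ∀ {x u v} → kind x ≡ block → kind u ≡ centre v → Adj x u → ⊥
    block-centre {blk q j} {hub i σ} refl refl (t , ())
    block-far : ∀ {x u v z} → kind x ≡ block → kind u ≡ centre v → Adj x z → Adj u z → ⊥
    block-far {blk q j} {hub i false} refl refl (t , refl) (zero , ())
    block-far {blk q j} {hub i true}  refl refl (t , refl) (zero , ())
    block-far {blk q j} {hub i σ}     refl refl (t , refl) (suc y , ())

  Coded : Set
  Coded = Σ (Fin (2 + l)) (λ i → Fin 2 ⊎ (Fin (a i) ⊎ Fin (b i))) ⊎ Σ (Fin c) (λ _ → Fin (2 + k))

  decode : Coded → Vertex
  decode (inj₁ (i , inj₁ zero))       = hub i false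
  decode (inj₁ (i , inj₁ (suc zero))) = hub i true
  decode (inj₁ (i , inj₂ v))          = tip i v
  decode (inj₂ (q , j))               = blk q j

  encode : Vertex → Coded
  encode (hub i false) = inj₁ (i , inj₁ zero)
  encode (hub i true)  = inj₁ (i , inj₁ (suc zero))
  encode (tip i v)     = inj₁ (i , inj₂ v)
  encode (blk q j)     = inj₂ (q , j)

  decode-encode : ∀ v → decode (encode v) ≡ v
  decode-encode (hub i false) = refl
  decode-encode (hub i true)  = refl
  decode-encode (tip i v)     = refl
  decode-encode (blk q j)     = refl

  encode-decode : ∀ x → encode (decode x) ≡ x
  encode-decode (inj₁ (i , inj₁ zero))       = refl
  encode-decode (inj₁ (i , inj₁ (suc zero))) = refl
  encode-decode (inj₁ (i , inj₂ v))          = refl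
  encode-decode (inj₂ (q , j))               = refl

  private
    star : ∀ i → Finite (Fin 2 ⊎ (Fin (a i) ⊎ Fin (b i))) (2 + (a i + b i))
    star i = finite-⊎ finite-Fin (finite-⊎ finite-Fin finite-Fin)

    coded : Finite Coded (sum (λ i → 2 + (a i + b i)) + sum {c} (λ _ → 2 + k))
    coded = finite-⊎ (finite-Σ star) (finite-Σ (λ _ → finite-Fin))

  open FromNeighbours (finite-iso decode encode decode-encode encode-decode coded) neighbours public using (graph)
  open FromNeighbours (finite-iso decode encode decode-encode encode-decode coded) neighbours using (degree-sum; doubleStars)

  graph-saturated : CatSaturated k graph
  graph-saturated = Saturation.saturated graph (doubleStars stars)

  graph-edges : 2 * edgeCount graph ≡ sum (λ i → suc (a i) + suc (b i) + (a i + b i) * suc k) + c * ((2 + k) * suc k)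
  graph-edges = begin
    2 * edgeCount graph                                                                           ≡⟨ degree-sum ⟩
    total coded (degree ∘ decode)                                                                 ≡⟨ total-⊎ (finite-Σ star) (finite-Σ {c} (λ _ → finite-Fin)) (degree ∘ decode) ⟩
    total (finite-Σ star) (degree ∘ decode ∘ inj₁) + total (finite-Σ {c} (λ _ → finite-Fin)) (degree ∘ decode ∘ inj₂)
      ≡⟨ cong₂ _+_ (trans (total-Σ star (degree ∘ decode ∘ inj₁)) (sum-cong-≗ {2 + l} star-degree)) (trans (total-Σ {c} (λ _ → finite-Fin) (degree ∘ decode ∘ inj₂)) (trans (sum-cong-≗ {c} (λ _ → sum-const (2 + k) (suc k))) (sum-const c _))) ⟩
    sum (λ i → suc (a i) + suc (b i) + (a i + b i) * suc k) + c * ((2 + k) * suc k)               ∎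
    where
    open ≡-Reasoning
    star-degree : ∀ i → total (star i) (λ w → degree (decode (inj₁ (i , w)))) ≡ suc (a i) + suc (b i) + (a i + b i) * suc k
    star-degree i = begin
      total (star i) f                                                      ≡⟨ total-⊎ finite-Fin (finite-⊎ finite-Fin finite-Fin) f ⟩
      suc (a i) + (suc (b i) + 0) + total (finite-⊎ finite-Fin finite-Fin) (f ∘ inj₂)
        ≡⟨ cong₂ _+_ (cong (suc (a i) +_) (+-identityʳ (suc (b i)))) (trans (total-⊎ finite-Fin finite-Fin (f ∘ inj₂)) (cong₂ _+_ (sum-const (a i) (suc k)) (sum-const (b i) (suc k)))) ⟩
      suc (a i) + suc (b i) + (a i * suc k + b i * suc k)                   ≡⟨ cong ((suc (a i) + suc (b i)) +_) (*-distribʳ-+ (suc k) (a i) (b i)) ⟨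
      suc (a i) + suc (b i) + (a i + b i) * suc k                           ∎
      where
      f : Fin 2 ⊎ (Fin (a i) ⊎ Fin (b i)) → ℕ
      f w = degree (decode (inj₁ (i , w)))

-- All pieces but the first have the least size, giving 2 s + 4 vertices together with their hubs.
-- The first absorbs the residue: `e` further leaves on each side and `o` more on the left.
module Extended (k l c e o : ℕ) (c≤1 : c ≤ 1) (piece₀ : Piece k (o + (k + (2 + e))) (k + (2 + e))) where

  private
    a b : Fin (2 + l) → ℕ
    a zero    = o + (k + (2 + e))
    a (suc _) = k + 2
    b zero    = k + (2 + e)
    b (suc _) = k + 2

    piece : ∀ i → Piece k (a i) (b i)
    piece zero    = piece₀
    piece (suc _) = even-piece k 0

  open Construction k l c c≤1 piece

  order : ℕ
  order = (2 + l) * (2 * suc k + 4) + c * (suc k + 1) + (e + e + o)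

  private
    order-eq : sum (λ i → 2 + (a i + b i)) + sum {c} (λ _ → 2 + k) ≡ order
    order-eq = trans (cong₂ (λ x y → 2 + (a zero + b zero) + x + y) (sum-const (1 + l) (2 + (k + 2 + (k + 2)))) (sum-const c (2 + k)))
      (identity k l c e o)
      where
      identity : ∀ k l c e o → 2 + (o + (k + (2 + e)) + (k + (2 + e))) + (1 + l) * (2 + (k + 2 + (k + 2))) + c * (2 + k)
        ≡ (2 + l) * (2 * (1 + k) + 4) + c * ((1 + k) + 1) + (e + e + o)
      identity = solve-∀

    -- Only hubs exceed degree s: each by 2, hence 4 for every piece, and by 1 more for each leaf
    -- beyond the least size.
    edges-eq : 2 * edgeCount graph ≡ suc k * order + (4 * (2 + l) + (e + e + o))
    edges-eq = trans graph-edges (trans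
      (cong (λ x → suc (a zero) + suc (b zero) + (a zero + b zero) * suc k + x + c * ((2 + k) * suc k))
        (sum-const (1 + l) (suc (k + 2) + suc (k + 2) + (k + 2 + (k + 2)) * suc k)))
      (identity k l c e o))
      where
      identity : ∀ k l c e o →
        1 + (o + (k + (2 + e))) + (1 + (k + (2 + e))) + (o + (k + (2 + e)) + (k + (2 + e))) * (1 + k)
          + (1 + l) * ((1 + (k + 2)) + (1 + (k + 2)) + (k + 2 + (k + 2)) * (1 + k)) + c * ((2 + k) * (1 + k))
        ≡ (1 + k) * ((2 + l) * (2 * (1 + k) + 4) + c * ((1 + k) + 1) + (e + e + o)) + (4 * (2 + l) + (e + e + o))
      identity = solve-∀

  extended : Σ (SimpleGraph order) λ G → CatSaturated k G × 2 * edgeCount G ≡ suc k * order + (4 * (2 + l) + (e + e + o))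
  extended = subst (λ n → Σ (SimpleGraph n) λ G → CatSaturated k G × 2 * edgeCount G ≡ suc k * order + (4 * (2 + l) + (e + e + o)))
    order-eq (graph , graph-saturated , edges-eq)

-- The upper bound multiplied by 2 (s + 2). The term 4 (s + 2) (2 + l) is twice the number of
-- vertices in smallest double stars, so with 2 r it is covered by 2 n. What remains is s r, at most
-- 2 s (s + 1), which is the source of the second constant.
sparse-arith : ∀ s l c r n x → n ≡ (2 + l) * (2 * s + 4) + c * (s + 1) + r → r ≤ 2 * s + 2 → 2 * x ≡ s * n + (4 * (2 + l) + r) →
  2 * ((s + 2) * x) ≤ (s * (s + 2) + 2) * n + 2 * (s * (s + 1))
sparse-arith s l c r n x n≡ r≤ x≡ = begin
  2 * ((s + 2) * x)                                                  ≡⟨ swap (s + 2) x ⟩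
  (s + 2) * (2 * x)                                                  ≡⟨ cong ((s + 2) *_) x≡ ⟩
  (s + 2) * (s * n + (4 * (2 + l) + r))                              ≡⟨ expand s n l r ⟩
  s * (s + 2) * n + (4 * (s + 2) * (2 + l) + 2 * r) + s * r          ≤⟨ +-monoʳ-≤ (s * (s + 2) * n + (4 * (s + 2) * (2 + l) + 2 * r)) (*-monoʳ-≤ s r≤) ⟩
  s * (s + 2) * n + (4 * (s + 2) * (2 + l) + 2 * r) + s * (2 * s + 2)
    ≤⟨ m≤m+n _ (2 * (c * (s + 1))) ⟩
  s * (s + 2) * n + (4 * (s + 2) * (2 + l) + 2 * r) + s * (2 * s + 2) + 2 * (c * (s + 1))
    ≡⟨ collect s (s * (s + 2) * n) l r c ⟩
  s * (s + 2) * n + 2 * ((2 + l) * (2 * s + 4) + c * (s + 1) + r) + 2 * (s * (s + 1))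
    ≡⟨ cong (λ t → s * (s + 2) * n + 2 * t + 2 * (s * (s + 1))) n≡ ⟨
  s * (s + 2) * n + 2 * n + 2 * (s * (s + 1))                        ≡⟨ cong (_+ 2 * (s * (s + 1))) (*-distribʳ-+ n (s * (s + 2)) 2) ⟨
  (s * (s + 2) + 2) * n + 2 * (s * (s + 1))                          ∎
  where
  open ≤-Reasoning
  swap : ∀ t x → 2 * (t * x) ≡ t * (2 * x)
  swap = solve-∀
  expand : ∀ s n l r → (s + 2) * (s * n + (4 * (2 + l) + r)) ≡ s * (s + 2) * n + (4 * (s + 2) * (2 + l) + 2 * r) + s * r
  expand = solve-∀
  collect : ∀ s x l r c → x + (4 * (s + 2) * (2 + l) + 2 * r) + s * (2 * s + 2) + 2 * (c * (s + 1))
    ≡ x + 2 * ((2 + l) * (2 * s + 4) + c * (s + 1) + r) + 2 * (s * (s + 1))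
  collect = solve-∀

-- Choosing the parameters for a given order

half : ∀ n → ∃ λ h → n ≡ h + h ⊎ n ≡ suc (h + h)
half zero = 0 , inj₁ refl
half (suc n) with half n
... | h , inj₁ e = h , inj₂ (cong suc e)
... | h , inj₂ e = suc h , inj₁ (trans (cong suc e) (cong suc (≡-sym (+-suc h h))))

double≤⇒≤ : ∀ {a h} → a + a ≤ suc (h + h) → a ≤ h
double≤⇒≤ {a} {h} p with a ≤? h
... | yes q = q
... | no ¬q = ⊥-elim (<-irrefl refl (≤-trans (≤-trans (≤-reflexive (cong suc (≡-sym (+-suc h h)))) (+-mono-≤ (≰⇒> ¬q) (≰⇒> ¬q))) p))

-- Two multiples are set aside before dividing, so that the quotient is visibly at least 2.
divide : ∀ d {x} → 2 * suc d ≤ x → ∃ λ l → ∃ λ ρ → x ≡ (2 + l) * suc d + ρ × ρ ≤ d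
divide d {x} 2d≤x = l , ρ , eq , ≤-pred (m%n<n y (suc d))
  where
  open ≡-Reasoning
  y l ρ : ℕ
  y = x ∸ 2 * suc d
  l = y ℕ./ suc d
  ρ = y % suc d
  rearrange : ∀ d l ρ → 2 * d + (ρ + l * d) ≡ (2 + l) * d + ρ
  rearrange = solve-∀
  eq : x ≡ (2 + l) * suc d + ρ
  eq = begin
    x                               ≡⟨ m+[n∸m]≡n 2d≤x ⟨
    2 * suc d + y                   ≡⟨ cong ((2 * suc d) +_) (m≡m%n+[m/n]*n y (suc d)) ⟩
    2 * suc d + (ρ + l * suc d)     ≡⟨ rearrange (suc d) l ρ ⟩
    (2 + l) * suc d + ρ             ∎

-- A fixed point j of the reversal would satisfy 2 j + 1 = 2 t.
opposite≢-even : ∀ t (j : Fin (t + t)) → opposite j ≢ j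
opposite≢-even t j e = odd≢even t (toℕ j) (begin
  suc (toℕ j + toℕ j)                       ≡⟨ cong (λ i → suc (toℕ j + i)) (trans (cong toℕ (≡-sym e)) (Fin.opposite-prop j)) ⟩
  suc (toℕ j + (t + t ∸ suc (toℕ j)))       ≡⟨ m+[n∸m]≡n (Fin.toℕ<n j) ⟩
  t + t                                     ∎)
  where
  open ≡-Reasoning
  odd≢even : ∀ t j → suc (j + j) ≢ t + t
  odd≢even (suc t) zero    h = 0≢1+n (suc-injective (trans h (cong suc (+-suc t t))))
  odd≢even (suc t) (suc j) h = odd≢even t j (suc-injective (suc-injective (trans (cong (λ x → suc (suc x)) (≡-sym (+-suc j j))) (trans h (cong suc (+-suc t t))))))

-- The parameters of `Extended`. The field `few` is what the second constant can afford. An odd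
-- residue requires `odd-piece`, whose matching on `k` leaves exists only for even `k`.
record Shape (k n : ℕ) : Set where
  constructor shape
  field
    l c e o : ℕ
    c≤1     : c ≤ 1
    order   : n ≡ (2 + l) * (2 * suc k + 4) + c * (suc k + 1) + (e + e + o)
    few     : e + e + o ≤ 2 * suc k + 2
    parity  : o ≡ 0 ⊎ (o ≡ 1 × ∃ λ t → k ≡ t + t)

-- When n and k are odd, the clique is needed: the rest of the graph has even order.
find-shape : ∀ k n → 2 * (2 * suc k + 4) + suc k + 1 ≤ n → Shape k n
find-shape k n n≥ with half n | half k
... | h , inj₁ n≡ | _ = even-order (divide (k + 2) (double≤⇒≤ (≤-trans h≥ (n≤1+n (h + h)))))
  where
  open ≤-Reasoning
  h≥ : 2 * suc (k + 2) + 2 * suc (k + 2) ≤ h + h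
  h≥ = begin
    2 * suc (k + 2) + 2 * suc (k + 2)         ≤⟨ m≤m+n _ (2 + k) ⟩
    2 * suc (k + 2) + 2 * suc (k + 2) + (2 + k) ≡⟨ identity k ⟩
    2 * (2 * suc k + 4) + suc k + 1           ≤⟨ n≥ ⟩
    n                                         ≡⟨ n≡ ⟩
    h + h                                     ∎
    where
    identity : ∀ k → 2 * (1 + (k + 2)) + 2 * (1 + (k + 2)) + (2 + k) ≡ 2 * (2 * (1 + k) + 4) + (1 + k) + 1
    identity = solve-∀
  even-order : (∃ λ l → ∃ λ ρ → h ≡ (2 + l) * suc (k + 2) + ρ × ρ ≤ k + 2) → Shape k n
  even-order (l , ρ , h≡ , ρ≤) = shape l 0 ρ 0 z≤n (trans n≡ (trans (cong (λ x → x + x) h≡) (identity k l ρ)))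
    (≤-trans (≤-reflexive (+-identityʳ (ρ + ρ))) (≤-trans (+-mono-≤ ρ≤ ρ≤) (≤-reflexive (room k)))) (inj₁ refl)
    where
    identity : ∀ k l ρ → (2 + l) * (1 + (k + 2)) + ρ + ((2 + l) * (1 + (k + 2)) + ρ) ≡ (2 + l) * (2 * (1 + k) + 4) + 0 * ((1 + k) + 1) + (ρ + ρ + 0)
    identity = solve-∀
    room : ∀ k → k + 2 + (k + 2) ≡ 2 * (1 + k) + 2
    room = solve-∀
... | h , inj₂ n≡ | t , inj₁ k≡ = odd-order (divide (k + 2) (double≤⇒≤ h≥))
  where
  open ≤-Reasoning
  h≥ : 2 * suc (k + 2) + 2 * suc (k + 2) ≤ suc (h + h)
  h≥ = begin
    2 * suc (k + 2) + 2 * suc (k + 2)         ≤⟨ m≤m+n _ (2 + k) ⟩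
    2 * suc (k + 2) + 2 * suc (k + 2) + (2 + k) ≡⟨ identity k ⟩
    2 * (2 * suc k + 4) + suc k + 1           ≤⟨ n≥ ⟩
    n                                         ≡⟨ n≡ ⟩
    suc (h + h)                               ∎
    where
    identity : ∀ k → 2 * (1 + (k + 2)) + 2 * (1 + (k + 2)) + (2 + k) ≡ 2 * (2 * (1 + k) + 4) + (1 + k) + 1
    identity = solve-∀
  odd-order : (∃ λ l → ∃ λ ρ → h ≡ (2 + l) * suc (k + 2) + ρ × ρ ≤ k + 2) → Shape k n
  odd-order (l , ρ , h≡ , ρ≤) with ρ ≟ℕ k + 2
  ... | no ρ≢ = shape l 0 ρ 1 z≤n (trans n≡ (trans (cong (λ x → suc (x + x)) h≡) (identity k l ρ)))
    (begin
      ρ + ρ + 1                     ≤⟨ +-monoˡ-≤ 1 (+-mono-≤ ρ<  ρ<) ⟩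
      k + 1 + (k + 1) + 1           ≤⟨ n≤1+n _ ⟩
      suc (k + 1 + (k + 1) + 1)     ≡⟨ room k ⟩
      2 * suc k + 2                 ∎) (inj₂ (refl , t , k≡))
    where
    ρ< : ρ ≤ k + 1
    ρ< = ≤-pred (≤-trans (≤∧≢⇒< ρ≤ ρ≢) (≤-reflexive (+-suc k 1)))
    identity : ∀ k l ρ → 1 + ((2 + l) * (1 + (k + 2)) + ρ + ((2 + l) * (1 + (k + 2)) + ρ)) ≡ (2 + l) * (2 * (1 + k) + 4) + 0 * ((1 + k) + 1) + (ρ + ρ + 1)
    identity = solve-∀
    room : ∀ k → 1 + (k + 1 + (k + 1) + 1) ≡ 2 * (1 + k) + 2
    room = solve-∀
  -- Here the residue would be 2 (k + 2) + 1 = 2 s + 3, one too many for `few`. Moving k + 2 of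
  -- these vertices into the clique leaves k + 3 = 2 (t + 1) + 1.
  ... | yes ρ≡ = shape l 1 (suc t) 1 ≤-refl order≡
    (begin
      suc t + suc t + 1             ≡⟨ three t ⟩
      t + t + 3                     ≡⟨ cong (_+ 3) k≡ ⟨
      k + 3                         ≤⟨ m≤m+n (k + 3) (k + 1) ⟩
      k + 3 + (k + 1)               ≡⟨ room k ⟩
      2 * suc k + 2                 ∎) (inj₂ (refl , t , k≡))
    where
    three : ∀ t → 1 + t + (1 + t) + 1 ≡ t + t + 3
    three = solve-∀
    room : ∀ k → k + 3 + (k + 1) ≡ 2 * (1 + k) + 2
    room = solve-∀
    identity : ∀ k l → 1 + ((2 + l) * (1 + (k + 2)) + (k + 2) + ((2 + l) * (1 + (k + 2)) + (k + 2))) ≡ (2 + l) * (2 * (1 + k) + 4) + 1 * ((1 + k) + 1) + (k + 3)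
    identity = solve-∀
    order≡ : n ≡ (2 + l) * (2 * suc k + 4) + 1 * (suc k + 1) + (suc t + suc t + 1)
    order≡ = begin-equality
      n                                                                           ≡⟨ n≡ ⟩
      suc (h + h)                                                                 ≡⟨ cong (λ x → suc (x + x)) (trans h≡ (cong (((2 + l) * suc (k + 2)) +_) ρ≡)) ⟩
      suc ((2 + l) * suc (k + 2) + (k + 2) + ((2 + l) * suc (k + 2) + (k + 2)))   ≡⟨ identity k l ⟩
      (2 + l) * (2 * suc k + 4) + 1 * (suc k + 1) + (k + 3)                       ≡⟨ cong (λ x → (2 + l) * (2 * suc k + 4) + 1 * (suc k + 1) + (x + 3)) k≡ ⟩
      (2 + l) * (2 * suc k + 4) + 1 * (suc k + 1) + (t + t + 3)                   ≡⟨ cong (((2 + l) * (2 * suc k + 4) + 1 * (suc k + 1)) +_) (three t) ⟨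
      (2 + l) * (2 * suc k + 4) + 1 * (suc k + 1) + (suc t + suc t + 1)           ∎
... | h , inj₂ n≡ | t , inj₂ k≡ = odd-order (divide (k + 2) (double≤⇒≤ (≤-trans h′≥ (n≤1+n (h′ + h′)))))
  where
  open ≤-Reasoning
  -- Taking the k + 2 = 2 t + 3 vertices of the clique from n = 2 h + 1 leaves twice h - (t + 1).
  -- The summand s + 1 in the bound on n ensures that two double stars still fit.
  h′ : ℕ
  h′ = h ∸ suc t
  k+2≡ : suc k + 1 ≡ suc (suc t + suc t)
  k+2≡ = trans (cong (λ x → suc x + 1) k≡) (three t)
    where
    three : ∀ t → 2 + (t + t) + 1 ≡ 1 + (1 + t + (1 + t))
    three = solve-∀
  big : 2 * suc (k + 2) + 2 * suc (k + 2) + suc (suc t + suc t) ≤ suc (h + h)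
  big = begin
    2 * suc (k + 2) + 2 * suc (k + 2) + suc (suc t + suc t)  ≡⟨ cong ((2 * suc (k + 2) + 2 * suc (k + 2)) +_) k+2≡ ⟨
    2 * suc (k + 2) + 2 * suc (k + 2) + (suc k + 1)          ≡⟨ identity k ⟩
    2 * (2 * suc k + 4) + suc k + 1                          ≤⟨ n≥ ⟩
    n                                                        ≡⟨ n≡ ⟩
    suc (h + h)                                              ∎
    where
    identity : ∀ k → 2 * (1 + (k + 2)) + 2 * (1 + (k + 2)) + (1 + k + 1) ≡ 2 * (2 * (1 + k) + 4) + (1 + k) + 1
    identity = solve-∀
  t<h : suc t ≤ h
  t<h = double≤⇒≤ (≤-trans (≤-trans (n≤1+n _) (m≤n+m _ (2 * suc (k + 2) + 2 * suc (k + 2)))) big)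
  h≡h′ : h ≡ suc t + h′
  h≡h′ = ≡-sym (m+[n∸m]≡n t<h)
  split : ∀ t x → suc (suc t + x + (suc t + x)) ≡ x + x + suc (suc t + suc t)
  split = solve-∀
  h′≥ : 2 * suc (k + 2) + 2 * suc (k + 2) ≤ h′ + h′
  h′≥ = +-cancelʳ-≤ (suc (suc t + suc t)) _ _ (≤-trans big (≤-reflexive (trans (cong (λ x → suc (x + x)) h≡h′) (split t h′))))
  odd-order : (∃ λ l → ∃ λ ρ → h′ ≡ (2 + l) * suc (k + 2) + ρ × ρ ≤ k + 2) → Shape k n
  odd-order (l , ρ , h′≡ , ρ≤) = shape l 1 ρ 0 ≤-refl order≡
    (≤-trans (≤-reflexive (+-identityʳ (ρ + ρ))) (≤-trans (+-mono-≤ ρ≤ ρ≤) (≤-reflexive (room k)))) (inj₁ refl)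
    where
    room : ∀ k → k + 2 + (k + 2) ≡ 2 * (1 + k) + 2
    room = solve-∀
    identity : ∀ k l ρ → (2 + l) * (1 + (k + 2)) + ρ + ((2 + l) * (1 + (k + 2)) + ρ) + (1 + k + 1) ≡ (2 + l) * (2 * (1 + k) + 4) + 1 * ((1 + k) + 1) + (ρ + ρ + 0)
    identity = solve-∀
    order≡ : n ≡ (2 + l) * (2 * suc k + 4) + 1 * (suc k + 1) + (ρ + ρ + 0)
    order≡ = begin-equality
      n                                              ≡⟨ n≡ ⟩
      suc (h + h)                                    ≡⟨ cong (λ x → suc (x + x)) h≡h′ ⟩
      suc (suc t + h′ + (suc t + h′))                ≡⟨ split t h′ ⟩
      h′ + h′ + suc (suc t + suc t)                  ≡⟨ cong₂ (λ x y → x + x + y) h′≡ (≡-sym k+2≡) ⟩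
      (2 + l) * suc (k + 2) + ρ + ((2 + l) * suc (k + 2) + ρ) + (suc k + 1) ≡⟨ identity k l ρ ⟩
      (2 + l) * (2 * suc k + 4) + 1 * (suc k + 1) + (ρ + ρ + 0) ∎

Sparse : ℕ → ℕ → Set
Sparse k n = Σ (SimpleGraph n) λ G → CatSaturated k G ×
  2 * ((suc k + 2) * edgeCount G) ≤ (suc k * (suc k + 2) + 2) * n + 2 * (suc k * (suc k + 1))

extended⇒sparse : ∀ k l c r n → n ≡ (2 + l) * (2 * suc k + 4) + c * (suc k + 1) + r → r ≤ 2 * suc k + 2 →
  (Σ (SimpleGraph n) λ G → CatSaturated k G × 2 * edgeCount G ≡ suc k * n + (4 * (2 + l) + r)) → Sparse k n
extended⇒sparse k l c r n n≡ r≤ (G , saturated , edges) = G , saturated , sparse-arith (suc k) l c r n (edgeCount G) n≡ r≤ edges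

sparse-saturated : ∀ k n → 2 * (2 * suc k + 4) + suc k + 1 ≤ n → Sparse k n
sparse-saturated k n n≥ = subst (Sparse k) (≡-sym order)
  (extended⇒sparse k l c (e + e + o) (Extended.order k l c e o c≤1 (piece₀ parity)) refl few (Extended.extended k l c e o c≤1 (piece₀ parity)))
  where
  open Shape (find-shape k n n≥)
  piece₀ : ∀ {o} → o ≡ 0 ⊎ (o ≡ 1 × ∃ λ t → k ≡ t + t) → Piece k (o + (k + (2 + e))) (k + (2 + e))
  piece₀ (inj₁ refl)              = even-piece k e
  piece₀ (inj₂ (refl , t , k≡)) = odd-piece k e (subst (λ k → (j : Fin k) → opposite j ≢ j) (≡-sym k≡) (opposite≢-even t))

-- Passing to rational numbers

open import Data.Integer using (+_)
open import Data.Rational using (ℚ; 0ℚ; _/_)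

frac : ℕ → ℕ → ℚ
frac a d = (+ a) / suc d

toℚᵘ-frac : ∀ a d → ℚ.toℚᵘ (frac a d) ℚᵘ.≃ ℚᵘ.mkℚᵘ (+ a) d
toℚᵘ-frac a d = ℚ.toℚᵘ-fromℚᵘ (ℚᵘ.mkℚᵘ (+ a) d)

-- Denominators are given by their predecessors, and `d + b * suc d` is the predecessor of the
-- product of the two.
frac-+ : ∀ a b c d → frac a b +ℚ frac c d ≡ frac (a * suc d + c * suc b) (d + b * suc d)
frac-+ a b c d = ℚ.toℚᵘ-injective (begin
  ℚ.toℚᵘ (frac a b +ℚ frac c d)                                  ≈⟨ ℚ.toℚᵘ-homo-+ (frac a b) (frac c d) ⟩
  ℚ.toℚᵘ (frac a b) ℚᵘ.+ ℚ.toℚᵘ (frac c d)                       ≈⟨ ℚᵘ.+-cong (toℚᵘ-frac a b) (toℚᵘ-frac c d) ⟩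
  ℚᵘ.mkℚᵘ (+ a) b ℚᵘ.+ ℚᵘ.mkℚᵘ (+ c) d                           ≡⟨ cong (λ z → ℚᵘ.mkℚᵘ z (d + b * suc d)) (cong₂ ℤ._+_ (ℤ.pos-* a (suc d)) (ℤ.pos-* c (suc b))) ⟨
  ℚᵘ.mkℚᵘ (+ (a * suc d + c * suc b)) (d + b * suc d)            ≈⟨ toℚᵘ-frac (a * suc d + c * suc b) (d + b * suc d) ⟨
  ℚ.toℚᵘ (frac (a * suc d + c * suc b) (d + b * suc d))          ∎)
  where open ℚᵘ.≃-Reasoning

frac-* : ∀ a b c d → frac a b *ℚ frac c d ≡ frac (a * c) (d + b * suc d)
frac-* a b c d = ℚ.toℚᵘ-injective (begin
  ℚ.toℚᵘ (frac a b *ℚ frac c d)                  ≈⟨ ℚ.toℚᵘ-homo-* (frac a b) (frac c d) ⟩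
  ℚ.toℚᵘ (frac a b) ℚᵘ.* ℚ.toℚᵘ (frac c d)       ≈⟨ ℚᵘ.*-cong (toℚᵘ-frac a b) (toℚᵘ-frac c d) ⟩
  ℚᵘ.mkℚᵘ (+ a) b ℚᵘ.* ℚᵘ.mkℚᵘ (+ c) d           ≡⟨ cong (λ z → ℚᵘ.mkℚᵘ z (d + b * suc d)) (ℤ.pos-* a c) ⟨
  ℚᵘ.mkℚᵘ (+ (a * c)) (d + b * suc d)            ≈⟨ toℚᵘ-frac (a * c) (d + b * suc d) ⟨
  ℚ.toℚᵘ (frac (a * c) (d + b * suc d))          ∎)
  where open ℚᵘ.≃-Reasoning

frac-≤ : ∀ a b c d → a * suc d ≤ c * suc b → frac a b ≤ℚ frac c d
frac-≤ a b c d h = ℚ.toℚᵘ-cancel-≤ (begin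
  ℚ.toℚᵘ (frac a b)     ≃⟨ toℚᵘ-frac a b ⟩
  ℚᵘ.mkℚᵘ (+ a) b       ≤⟨ ℚᵘ.*≤* (subst₂ ℤ._≤_ (ℤ.pos-* a (suc d)) (ℤ.pos-* c (suc b)) (ℤ.+≤+ h)) ⟩
  ℚᵘ.mkℚᵘ (+ c) d       ≃⟨ toℚᵘ-frac c d ⟨
  ℚ.toℚᵘ (frac c d)     ∎)
  where open ℚᵘ.≤-Reasoning

≤-+⇒-≤ : ∀ p q r → p ≤ℚ q +ℚ r → p -ℚ r ≤ℚ q
≤-+⇒-≤ p q r h = begin
  p -ℚ r               ≤⟨ ℚ.+-monoˡ-≤ (ℚ.- r) h ⟩
  q +ℚ r -ℚ r          ≡⟨ ℚ.+-assoc q r (ℚ.- r) ⟩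
  q +ℚ (r -ℚ r)        ≡⟨ cong (q +ℚ_) (ℚ.+-inverseʳ r) ⟩
  q +ℚ 0ℚ              ≡⟨ ℚ.+-identityʳ q ⟩
  q                    ∎
  where open ℚ.≤-Reasoning

lower-ℚ : ∀ s n x → 4 * ((s * (s + 3) + 2) * n) ≤ 8 * ((s + 3) * x) + (4 * (2 * s + 3) + (s + 3) * suc s ^ 2) →
  (ℕ→ℚ s +ℚ (+ 2) / (3 + s)) *ℚ ((+ n) / 2) -ℚ ((+ (2 * s + 3)) / (6 + 2 * s) +ℚ (+ ((s + 1) ^ 2)) / 8) ≤ℚ ℕ→ℚ x
lower-ℚ s n x h = ≤-+⇒-≤ ((ℕ→ℚ s +ℚ frac 2 (2 + s)) *ℚ frac n 1) (ℕ→ℚ x) (frac (2 * s + 3) (5 + 2 * s) +ℚ frac t 7) (subst₂ _≤ℚ_ (≡-sym left) (≡-sym right)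
  (frac-≤ ((s * suc (2 + s) + 2 * 1) * n) (1 + (2 + s + 0 * suc (2 + s)) * 2)
    (x * suc (7 + (5 + 2 * s) * 8) + ((2 * s + 3) * 8 + t * suc (5 + 2 * s)) * 1) (7 + (5 + 2 * s) * 8 + 0 * suc (7 + (5 + 2 * s) * 8)) bound))
  where
  open ≤-Reasoning
  t : ℕ
  t = (s + 1) ^ 2
  left : (ℕ→ℚ s +ℚ frac 2 (2 + s)) *ℚ frac n 1 ≡ frac ((s * suc (2 + s) + 2 * 1) * n) (1 + (2 + s + 0 * suc (2 + s)) * 2)
  left = trans (cong (_*ℚ frac n 1) (frac-+ s 0 2 (2 + s))) (frac-* (s * suc (2 + s) + 2 * 1) (2 + s + 0 * suc (2 + s)) n 1)
  right : ℕ→ℚ x +ℚ (frac (2 * s + 3) (5 + 2 * s) +ℚ frac t 7) ≡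
    frac (x * suc (7 + (5 + 2 * s) * 8) + ((2 * s + 3) * 8 + t * suc (5 + 2 * s)) * 1) (7 + (5 + 2 * s) * 8 + 0 * suc (7 + (5 + 2 * s) * 8))
  right = trans (cong (ℕ→ℚ x +ℚ_) (frac-+ (2 * s + 3) (5 + 2 * s) t 7)) (frac-+ x 0 ((2 * s + 3) * 8 + t * suc (5 + 2 * s)) (7 + (5 + 2 * s) * 8))
  -- Clearing denominators turns the claim into the hypothesis multiplied by 4 (s + 3).
  scaleˡ : ∀ s n → (s * (1 + (2 + s)) + 2 * 1) * n * (1 + (7 + (5 + 2 * s) * 8 + 0 * (1 + (7 + (5 + 2 * s) * 8)))) ≡ 4 * (s + 3) * (4 * ((s * (s + 3) + 2) * n))
  scaleˡ = solve-∀
  scaleʳ : ∀ s x t → 4 * (s + 3) * (8 * ((s + 3) * x) + (4 * (2 * s + 3) + (s + 3) * t)) ≡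
    (x * (1 + (7 + (5 + 2 * s) * 8)) + ((2 * s + 3) * 8 + t * (1 + (5 + 2 * s))) * 1) * (1 + (1 + (2 + s + 0 * (1 + (2 + s))) * 2))
  scaleʳ = solve-∀
  bound : (s * suc (2 + s) + 2 * 1) * n * suc (7 + (5 + 2 * s) * 8 + 0 * suc (7 + (5 + 2 * s) * 8)) ≤
    (x * suc (7 + (5 + 2 * s) * 8) + ((2 * s + 3) * 8 + t * suc (5 + 2 * s)) * 1) * suc (1 + (2 + s + 0 * suc (2 + s)) * 2)
  bound = begin
    (s * suc (2 + s) + 2 * 1) * n * suc (7 + (5 + 2 * s) * 8 + 0 * suc (7 + (5 + 2 * s) * 8))   ≡⟨ scaleˡ s n ⟩
    4 * (s + 3) * (4 * ((s * (s + 3) + 2) * n))                                                 ≤⟨ *-monoʳ-≤ (4 * (s + 3)) h ⟩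
    4 * (s + 3) * (8 * ((s + 3) * x) + (4 * (2 * s + 3) + (s + 3) * suc s ^ 2))                 ≡⟨ cong (λ u → 4 * (s + 3) * (8 * ((s + 3) * x) + (4 * (2 * s + 3) + (s + 3) * u ^ 2))) (+-comm 1 s) ⟩
    4 * (s + 3) * (8 * ((s + 3) * x) + (4 * (2 * s + 3) + (s + 3) * t))                         ≡⟨ scaleʳ s x t ⟩
    (x * suc (7 + (5 + 2 * s) * 8) + ((2 * s + 3) * 8 + t * suc (5 + 2 * s)) * 1) * suc (1 + (2 + s + 0 * suc (2 + s)) * 2) ∎

upper-ℚ : ∀ s n x → 2 * ((s + 2) * x) ≤ (s * (s + 2) + 2) * n + 2 * (s * (s + 1)) →
  ℕ→ℚ x ≤ℚ (ℕ→ℚ s +ℚ (+ 2) / (2 + s)) *ℚ ((+ n) / 2) +ℚ (+ (s * (s + 1))) / (2 + s)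
upper-ℚ s n x h = subst (ℕ→ℚ x ≤ℚ_) (≡-sym right) (frac-≤ x 0 ((s * suc (1 + s) + 2 * 1) * n * suc (1 + s) + t * suc d) (1 + s + d * suc (1 + s)) bound)
  where
  open ≤-Reasoning
  t d : ℕ
  t = s * (s + 1)
  d = 1 + (1 + s + 0 * suc (1 + s)) * 2
  right : (ℕ→ℚ s +ℚ frac 2 (1 + s)) *ℚ frac n 1 +ℚ frac t (1 + s) ≡
    frac ((s * suc (1 + s) + 2 * 1) * n * suc (1 + s) + t * suc d) (1 + s + d * suc (1 + s))
  right = trans (cong (λ p → p *ℚ frac n 1 +ℚ frac t (1 + s)) (frac-+ s 0 2 (1 + s)))
    (trans (cong (_+ℚ frac t (1 + s)) (frac-* (s * suc (1 + s) + 2 * 1) (1 + s + 0 * suc (1 + s)) n 1))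
      (frac-+ ((s * suc (1 + s) + 2 * 1) * n) d t (1 + s)))
  scaleˡ : ∀ s x → x * (1 + (1 + s + (1 + (1 + s + 0 * (1 + (1 + s))) * 2) * (1 + (1 + s)))) ≡ (s + 2) * (2 * ((s + 2) * x))
  scaleˡ = solve-∀
  scaleʳ : ∀ s n t → (s + 2) * ((s * (s + 2) + 2) * n + 2 * t) ≡
    ((s * (1 + (1 + s)) + 2 * 1) * n * (1 + (1 + s)) + t * (1 + (1 + (1 + s + 0 * (1 + (1 + s))) * 2))) * 1
  scaleʳ = solve-∀
  bound : x * suc (1 + s + d * suc (1 + s)) ≤ ((s * suc (1 + s) + 2 * 1) * n * suc (1 + s) + t * suc d) * 1
  bound = begin
    x * suc (1 + s + d * suc (1 + s))                                  ≡⟨ scaleˡ s x ⟩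
    (s + 2) * (2 * ((s + 2) * x))                                      ≤⟨ *-monoʳ-≤ (s + 2) h ⟩
    (s + 2) * ((s * (s + 2) + 2) * n + 2 * t)                          ≡⟨ scaleʳ s n t ⟩
    ((s * suc (1 + s) + 2 * 1) * n * suc (1 + s) + t * suc d) * 1      ∎

theorem3p8 : (s : ℕ) → 1 ≤ s → (n : ℕ) → qOf s * (2 * s + 4) + s + 1 ≤ n →
    ((G : SimpleGraph n) → CatSaturated (s Data.Nat.∸ 1) G →
    (ℕ→ℚ s +ℚ (+ 2) / (3 + s)) *ℚ ((+ n) / 2)
    -ℚ ((+ (2 * s + 3)) / (6 + 2 * s) +ℚ (+ ((s + 1) ^ 2)) / 8)
    ≤ℚ ℕ→ℚ (edgeCount G))
    × Σ (SimpleGraph n) (λ G → CatSaturated (s Data.Nat.∸ 1) G ×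
    (ℕ→ℚ (edgeCount G)
    ≤ℚ (ℕ→ℚ s +ℚ (+ 2) / (2 + s)) *ℚ ((+ n) / 2) +ℚ (+ (s * (s + 1))) / (2 + s)))
theorem3p8 (suc k) _ n n≥ = lower , upper (sparse-saturated k n 2-copies)
  where
  lower : (G : SimpleGraph n) → CatSaturated k G → _
  lower G saturated = lower-ℚ (suc k) n (edgeCount G) (LowerBound.edges-bound G saturated)
  -- As `qOf` is a maximum with 2, there is room for two double stars and the clique.
  2-copies : 2 * (2 * suc k + 4) + suc k + 1 ≤ n
  2-copies = ≤-trans (+-monoˡ-≤ 1 (+-monoˡ-≤ (suc k) (*-monoˡ-≤ (2 * suc k + 4) (m≤m⊔n 2 ⌊ k /2⌋)))) n≥
  upper : Sparse k n → _
  upper (G , saturated , edges) = G , saturated , upper-ℚ (suc k) n (edgeCount G) edges
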